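{- Over all \textsc{Snort} positions (finite simple graphs $G$), the difference $t(G)-\deg(G)$ is unbounded; that is, for every real $M$ there is a finite simple graph $G$ such that \textsc{Snort} played on $G$ satisfies $t(G)-\deg(G)>M$.
   Context: \textsc{Snort} is a two-player normal-play combinatorial game (the player unable to move loses) between Left (blue) and Right (red), played on a finite simple graph; players alternately colour an uncoloured vertex in their own colour, and a player may not colour a vertex adjacent to a vertex coloured by the opponent. $t(G)$ denotes the temperature (in the standard sense of combinatorial game theory, via thermographs) of the game \textsc{Snort} played on the uncoloured graph $G$, and $\deg(G)$ denotes the maximum degree of a vertex of $G$. -}

module Defs where

open import Data.Fin.Base using (Fin)
open import Data.Fin.Properties using (all?)
open import Data.Integer.Base using (ℤ; +_; -[1+_])
open import Data.List.Base using (List; allFin; filter; length; lookup; map)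
open import Data.List.Extrema.Nat using (max)
open import Data.Maybe.Base using (Maybe; just; nothing)
open import Data.Maybe.Properties using (≡-dec)
open import Data.Nat.Base using (ℕ; zero; suc)
open import Data.Product.Base using (Σ-syntax; ∃-syntax; _×_)
open import Data.Rational.Base using (ℚ; _/_; _+_; _-_; _≤_; _⊓_; -_; 1ℚ)
open import Data.Vec.Functional using (Vector; updateAt)
open import Level using (0ℓ)
open import Relation.Binary.Core using (Rel)
open import Relation.Binary.Definitions
  using (Decidable; DecidableEquality; Irreflexive; Symmetric)
open import Relation.Binary.PropositionalEquality.Core using (_≡_; refl; _≢_)
open import Relation.Nullary.Decidable.Core using (Dec; yes; no; _×-dec_; _→-dec_; ¬?)
open import Relation.Nullary.Negation.Core using (¬_)

------------------------------------------------------------------------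
-- Short games under normal play

-- ⟨ Gᴸ ∣ Gᴿ ⟩ has Left options Gᴸ i and Right options Gᴿ j.
data Game : Set where
  ⟨_∣_⟩ : ∀ {m n} → (Fin m → Game) → (Fin n → Game) → Game

infix 4 _≤ᴳ_ _≈ᴳ_

_≤ᴳ_ : Game → Game → Set
G@(⟨ Gᴸ ∣ _ ⟩) ≤ᴳ H@(⟨ _ ∣ Hᴿ ⟩) =
  (∀ i → ¬ (H ≤ᴳ Gᴸ i)) × (∀ j → ¬ (Hᴿ j ≤ᴳ G))

_≈ᴳ_ : Game → Game → Set
G ≈ᴳ H = G ≤ᴳ H × H ≤ᴳ G

noOptions : Fin 0 → Game
noOptions ()

oneOption : Game → Fin 1 → Game
oneOption G _ = G

-- The canonical forms 0 = { ∣ }, n + 1 = { n ∣ }, -(n + 1) = { ∣ -n }.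
integer : ℤ → Game
integer (+ zero)       = ⟨ noOptions ∣ noOptions ⟩
integer (+ suc n)      = ⟨ oneOption (integer (+ n)) ∣ noOptions ⟩
integer (-[1+ zero ])  = ⟨ noOptions ∣ oneOption (integer (+ zero)) ⟩
integer (-[1+ suc n ]) = ⟨ noOptions ∣ oneOption (integer (-[1+ n ])) ⟩

------------------------------------------------------------------------
-- Thermographs and temperature

-- Walls are functions of the temperature t, meaningful for t ≥ -1.  The walls
-- of a short game are piecewise linear with rational breakpoints, so
-- rational temperatures and stops suffice.
record Thermograph : Set where
  field
    leftWall rightWall : ℚ → ℚ
    temperature        : ℚ

open Thermograph public

IsMax IsMin : ∀ {n} → (Fin n → ℚ) → ℚ → Set
IsMax f x = (∃[ i ] f i ≡ x) × (∀ i → f i ≤ x)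
IsMin f x = (∃[ i ] f i ≡ x) × (∀ i → x ≤ f i)

IsLeastMeeting : (ℚ → ℚ) → (ℚ → ℚ) → ℚ → Set
IsLeastMeeting l r τ =
  - 1ℚ ≤ τ × l τ ≡ r τ × (∀ t → - 1ℚ ≤ t → l t ≡ r t → τ ≤ t)

-- If G equals an integer n, its thermograph is a mast at n and its
-- temperature is -1.  Otherwise the scaffolds of G are
--   l t = max (rightWall of Gᴸ at t) - t,  r t = min (leftWall of Gᴿ at t) + t,
-- its temperature is the least τ ≥ -1 at which they meet, and its walls follow
-- the scaffolds up to τ and are constant (the mast) from there on.  A game
-- with no options for one of the players equals an integer, so the maximum
-- and minimum are over nonempty families.
data IsThermographOf : Game → Thermograph → Set where

  mast : ∀ {G} (n : ℤ) → G ≈ᴳ integer n →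
         IsThermographOf G record
           { leftWall    = λ _ → n / 1
           ; rightWall   = λ _ → n / 1
           ; temperature = - 1ℚ
           }

  scaffolds : ∀ {m n} {Gᴸ : Fin m → Game} {Gᴿ : Fin n → Game}
              (Tᴸ : Fin m → Thermograph) (Tᴿ : Fin n → Thermograph)
              (l r : ℚ → ℚ) (τ : ℚ) →
              (∀ k → ¬ (⟨ Gᴸ ∣ Gᴿ ⟩ ≈ᴳ integer k)) →
              (∀ i → IsThermographOf (Gᴸ i) (Tᴸ i)) →
              (∀ j → IsThermographOf (Gᴿ j) (Tᴿ j)) →
              (∀ t → IsMax (λ i → rightWall (Tᴸ i) t - t) (l t)) →
              (∀ t → IsMin (λ j → leftWall (Tᴿ j) t + t) (r t)) →
              IsLeastMeeting l r τ →
              IsThermographOf ⟨ Gᴸ ∣ Gᴿ ⟩ record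
                { leftWall    = λ t → l (t ⊓ τ)
                ; rightWall   = λ t → r (t ⊓ τ)
                ; temperature = τ
                }

HasTemperature : Game → ℚ → Set
HasTemperature G τ = Σ[ T ∈ Thermograph ] IsThermographOf G T × temperature T ≡ τ

------------------------------------------------------------------------
-- Finite simple graphs

record Graph : Set₁ where
  infix 4 _~_ _~?_
  field
    order  : ℕ
    _~_    : Rel (Fin order) 0ℓ
    _~?_   : Decidable _~_
    sym    : Symmetric _~_
    irrefl : Irreflexive _≡_ _~_

  Vertex : Set
  Vertex = Fin order

  degree : Vertex → ℕ
  degree v = length (filter (v ~?_) (allFin order))

  -- 0 for the graph without vertices
  maxDegree : ℕ
  maxDegree = max 0 (map degree (allFin order))

------------------------------------------------------------------------
-- Snort

data Player : Set where
  Left Right : Player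

opponent : Player → Player
opponent Left  = Right
opponent Right = Left

_≟ᴾ_ : DecidableEquality Player
Left  ≟ᴾ Left  = yes refl
Left  ≟ᴾ Right = no λ ()
Right ≟ᴾ Left  = no λ ()
Right ≟ᴾ Right = yes refl

module Snort (Γ : Graph) where
  open Graph Γ

  -- nothing means uncoloured
  Colouring : Set
  Colouring = Vector (Maybe Player) order

  Legal : Player → Colouring → Vertex → Set
  Legal p c v = c v ≡ nothing × (∀ w → v ~ w → c w ≢ just (opponent p))

  legal? : ∀ p c v → Dec (Legal p c v)
  legal? p c v = ≡-dec _≟ᴾ_ (c v) nothing
           ×-dec all? (λ w → (v ~? w) →-dec ¬? (≡-dec _≟ᴾ_ (c w) (just (opponent p))))

  moves : Player → Colouring → List Vertex
  moves p c = filter (legal? p c) (allFin order)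

  play : Player → Vertex → Colouring → Colouring
  play p v c = updateAt c v (λ _ → just p)

  -- The first argument bounds the length of play.  The game tree is complete
  -- as soon as it is at least the number of uncoloured vertices.
  position : ℕ → Colouring → Game
  position zero    c = ⟨ noOptions ∣ noOptions ⟩
  position (suc k) c =
    ⟨ (λ i → position k (play Left  (lookup (moves Left  c) i) c))
    ∣ (λ j → position k (play Right (lookup (moves Right c) j) c)) ⟩

snort : Graph → Game
snort Γ = position order (λ _ → nothing)
  where open Graph Γ; open Snort Γ

{-# OPTIONS --safe #-}
module Submission where

-- Let G be a centre joined to 2g hubs, each hub carrying three leaves; its maximum
-- degree is 2g for g ≥ 2.  Once Left has coloured the centre, only Left can use a
-- hub, and colouring it reserves its three leaves; Right can only prevent this by
-- colouring one of them, which kills the hub.  Pair the hubs: whenever Right kills a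
-- hub, Left takes its partner.  So each pair is worth at least 3 to Left even if
-- Right starts, the whole position is at least 3g, and by symmetry Right can reach
-- a position of value at most -3g.  An option at least the integer k keeps the left
-- scaffold above k - t at every t ≥ -1, whence the temperature is at least 3g.
--
-- Thermographs exist for all short games because all walls are piecewise affine, so
-- scaffolds that start in the order l > r at t = -1 have a first meeting point; if
-- instead l ≤ r at t = -1, then an integer separates the left options from the
-- right options and the game equals the simplest such integer.

open import Defs

open import Data.Bool.Base using (Bool; T; _∧_; _xor_)
open import Data.Bool.Properties using (T?)
open import Data.Empty using (⊥; ⊥-elim)
open import Data.Fin.Base using (Fin; zero; suc; toℕ; combine; remQuot)
open import Data.Fin.Properties as Fin using (all?; any?)
open import Data.Integer.Base as ℤ using (ℤ; +_; -[1+_])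
import Data.Integer.DivMod as ℤ
import Data.Integer.Properties as ℤ
open import Data.List.Base as List using (List; []; _∷_; allFin; filter; length)
open import Data.List.Extrema.Nat using (max≤v⁺)
open import Data.List.Membership.Propositional using (_∈_)
open import Data.List.Membership.Propositional.Properties
  using (∈-allFin; ∈-filter⁺; ∈-filter⁻; ∈-lookup)
open import Data.List.Relation.Unary.All as All using ()
import Data.List.Relation.Unary.All.Properties as All
open import Data.List.Relation.Unary.AllPairs using (_∷_)
open import Data.List.Relation.Unary.Any using (index)
open import Data.List.Relation.Unary.Any.Properties using (lookup-index)
open import Data.List.Relation.Unary.Unique.Propositional using (Unique)
open import Data.List.Relation.Unary.Unique.Propositional.Properties using (filter⁺; allFin⁺)
open import Data.Maybe.Base using (Maybe; just; nothing)
open import Data.Maybe.Properties using (≡-dec; just-injective)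
open import Data.Nat.Base as ℕ
  using (ℕ; zero; suc; z≤n; s≤s; pred; _<ᵇ_; _≡ᵇ_; _%_)
open import Data.Nat.DivMod using (_mod_)
import Data.Nat.Properties as ℕ
open import Data.Nat.Tactic.RingSolver using () renaming (solve-∀ to ℕ-solve-∀)
open import Data.Product.Base
  using (Σ-syntax; ∃; ∃-syntax; _×_; _,_; proj₁; proj₂; uncurry)
open import Data.Rational.Base
open import Data.Rational.Properties
import Data.Rational.Unnormalised.Base as ℚᵘ
import Data.Rational.Unnormalised.Properties as ℚᵘ
open import Data.Sum.Base using (_⊎_; inj₁; inj₂; [_,_]′)
open import Data.Unit.Base using (⊤; tt)
open import Data.Vec.Base using (Vec; lookup; replicate; _[_]≔_)
open import Data.Vec.Properties using (lookup∘update; lookup∘update′; lookup-replicate)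
open import Data.Vec.Functional using (Vector; updateAt; foldr)
open import Data.Vec.Functional.Properties using (updateAt-updates; updateAt-minimal)
open import Function.Base using (_∘_; const)
open import Relation.Binary.Definitions using (tri<; tri≈; tri>)
open import Relation.Binary.PropositionalEquality
  using (_≡_; _≢_; refl; sym; trans; cong; cong₂; subst; subst₂)
open import Relation.Nullary using (¬_; Dec; yes; no; ¬?; contradiction; _×-dec_; _→-dec_)
open import Relation.Nullary.Decidable using (dec⇒maybe; decidable-stable; toWitness)
open import Tactic.RingSolver using (solve; solve-∀)
open import Tactic.RingSolver.Core.AlmostCommutativeRing
  using (AlmostCommutativeRing; fromCommutativeRing)

-- Rational arithmetic

ℚ-ring : AlmostCommutativeRing _ _
ℚ-ring = fromCommutativeRing +-*-commutativeRing λ x → dec⇒maybe (0ℚ ≟ x)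

-- The last hypothesis is y - x ≡ (b - a) + (d - c), moved around for the ring solver.
≤-linear : ∀ {a b c d x y} → a ≤ b → c ≤ d → x + (b + d) ≡ y + (a + c) → x ≤ y
≤-linear {a} {b} {c} {d} {x} {y} a≤b c≤d eq =
  subst₂ _≤_ (cancel x (b + d)) (cancel y (b + d))
    (+-monoˡ-≤ (- (b + d))
      (≤-trans (≤-reflexive eq) (+-monoʳ-≤ y (+-mono-≤ a≤b c≤d))))
  where
  cancel : ∀ u v → u + v - v ≡ u
  cancel = solve-∀ ℚ-ring

<-linear : ∀ {a b c d x y} → a < b → c ≤ d → x + (b + d) ≡ y + (a + c) → x < y
<-linear {a} {b} {c} {d} {x} {y} a<b c≤d eq =
  subst₂ _<_ (cancel x (b + d)) (cancel y (b + d))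
    (+-monoˡ-< (- (b + d))
      (≤-<-trans (≤-reflexive eq) (+-monoʳ-< y (+-mono-<-≤ a<b c≤d))))
  where
  cancel : ∀ u v → u + v - v ≡ u
  cancel = solve-∀ ℚ-ring

-- `_/_` divides by a gcd that does not reduce for a variable numerator, so facts about `n / 1` are
-- proved on unnormalised rationals and carried back.
toℚᵘ-/1 : ∀ n → toℚᵘ (n / 1) ℚᵘ.≃ ℚᵘ.mkℚᵘ n 0
toℚᵘ-/1 n = toℚᵘ-fromℚᵘ (ℚᵘ.mkℚᵘ n 0)

/1-mono-≤ : ∀ {m n} → m ℤ.≤ n → m / 1 ≤ n / 1
/1-mono-≤ {m} {n} m≤n = toℚᵘ-cancel-≤
  (ℚᵘ.≤-respˡ-≃ (ℚᵘ.≃-sym (toℚᵘ-/1 m)) (ℚᵘ.≤-respʳ-≃ (ℚᵘ.≃-sym (toℚᵘ-/1 n))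
    (ℚᵘ.*≤* (ℤ.*-monoʳ-≤-nonNeg (+ 1) m≤n))))

/1-homo-+ : ∀ m n → (m ℤ.+ n) / 1 ≡ m / 1 + n / 1
/1-homo-+ m n = toℚᵘ-injective (begin-equality
  toℚᵘ ((m ℤ.+ n) / 1)               ≃⟨ toℚᵘ-/1 (m ℤ.+ n) ⟩
  ℚᵘ.mkℚᵘ (m ℤ.+ n) 0                ≃⟨ ℚᵘ.*≡* (cong (ℤ._* + 1)
                                           (sym (cong₂ ℤ._+_ (ℤ.*-identityʳ m) (ℤ.*-identityʳ n)))) ⟩
  ℚᵘ.mkℚᵘ m 0 ℚᵘ.+ ℚᵘ.mkℚᵘ n 0       ≃⟨ ℚᵘ.+-cong (ℚᵘ.≃-sym (toℚᵘ-/1 m)) (ℚᵘ.≃-sym (toℚᵘ-/1 n)) ⟩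
  toℚᵘ (m / 1) ℚᵘ.+ toℚᵘ (n / 1)     ≃⟨ ℚᵘ.≃-sym (toℚᵘ-homo-+ (m / 1) (n / 1)) ⟩
  toℚᵘ (m / 1 + n / 1)               ∎)
  where open ℚᵘ.≤-Reasoning

/1-suc : ∀ n → ℤ.suc n / 1 ≡ n / 1 + 1ℚ
/1-suc n = trans (/1-homo-+ (+ 1) n) (+-comm 1ℚ (n / 1))

/1-homo-neg : ∀ n → (ℤ.- n) / 1 ≡ - (n / 1)
/1-homo-neg n = trans (lemma ((ℤ.- n) / 1) (n / 1))
  (trans (cong (_- n / 1) (trans (sym (/1-homo-+ (ℤ.- n) n)) (cong (_/ 1) (ℤ.+-inverseˡ n))))
         (+-identityˡ (- (n / 1))))
  where
  lemma : ∀ a b → a ≡ a + b - b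
  lemma = solve-∀ ℚ-ring

floor-≤ : ∀ x → floor x / 1 ≤ x
floor-≤ x@record{} = toℚᵘ-cancel-≤ (ℚᵘ.≤-respˡ-≃ (ℚᵘ.≃-sym (toℚᵘ-/1 (floor x)))
  (ℚᵘ.*≤* (ℤ.≤-trans (ℤ.[n/d]*d≤n (↥ x) (↧ x)) (ℤ.≤-reflexive (sym (ℤ.*-identityʳ (↥ x)))))))

<-floor+1 : ∀ x → x < floor x / 1 + 1ℚ
<-floor+1 x@record{} = subst (x <_) (/1-suc (floor x)) (toℚᵘ-cancel-<
  (ℚᵘ.<-respʳ-≃ (ℚᵘ.≃-sym (toℚᵘ-/1 (ℤ.suc (floor x))))
    (ℚᵘ.*<* (subst₂ (λ n q → n ℤ.< ℤ.suc q ℤ.* ↧ x)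
      (sym (ℤ.*-identityʳ (↥ x))) (sym (ℤ.div-pos-is-/ℕ (↥ x) (↧ₙ x)))
      (ℤ.n<s[n/ℕd]*d (↥ x) (↧ₙ x))))))

-- Piecewise affine functions

-- Neighbouring pieces both hold at their common endpoint `c`. This builds in continuity: a sign
-- change cannot jump over a zero.
data PiecewiseAffine (f : ℚ → ℚ) (a b : ℚ) : Set where
  affine : ∀ p q → (∀ t → a ≤ t → t ≤ b → f t ≡ p * t + q) → PiecewiseAffine f a b
  split  : ∀ c → a ≤ c → c ≤ b →
           PiecewiseAffine f a c → PiecewiseAffine f c b → PiecewiseAffine f a b

piecewiseAffine-cong : ∀ {f g a b} → (∀ t → a ≤ t → t ≤ b → f t ≡ g t) →
                       PiecewiseAffine f a b → PiecewiseAffine g a b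
piecewiseAffine-cong f≡g (affine p q eq) =
  affine p q λ t a≤t t≤b → trans (sym (f≡g t a≤t t≤b)) (eq t a≤t t≤b)
piecewiseAffine-cong f≡g (split c a≤c c≤b F G) = split c a≤c c≤b
  (piecewiseAffine-cong (λ t a≤t t≤c → f≡g t a≤t (≤-trans t≤c c≤b)) F)
  (piecewiseAffine-cong (λ t c≤t t≤b → f≡g t (≤-trans a≤c c≤t) t≤b) G)

restrict : ∀ {f a b a′ b′} → a ≤ a′ → a′ ≤ b′ → b′ ≤ b →
           PiecewiseAffine f a b → PiecewiseAffine f a′ b′
restrict a≤a′ _ b′≤b (affine p q eq) =
  affine p q λ t a′≤t t≤b′ → eq t (≤-trans a≤a′ a′≤t) (≤-trans t≤b′ b′≤b)
restrict {a′ = a′} {b′} a≤a′ a′≤b′ b′≤b (split c a≤c c≤b F G)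
  with ≤-total c a′ | ≤-total b′ c
... | inj₁ c≤a′ | _         = restrict c≤a′ a′≤b′ b′≤b G
... | inj₂ a′≤c | inj₁ b′≤c = restrict a≤a′ a′≤b′ b′≤c F
... | inj₂ a′≤c | inj₂ c≤b′ =
  split c a′≤c c≤b′ (restrict a≤a′ a′≤c ≤-refl F) (restrict ≤-refl c≤b′ b′≤b G)

module _ (_∙_ : ℚ → ℚ → ℚ)
         (affine-∙ : ∀ p q p′ q′ {a b} →
                     PiecewiseAffine (λ t → (p * t + q) ∙ (p′ * t + q′)) a b) where

  zipWith-affine : ∀ {f g : ℚ → ℚ} {a b} p q → (∀ t → a ≤ t → t ≤ b → f t ≡ p * t + q) →
                   PiecewiseAffine g a b → PiecewiseAffine (λ t → f t ∙ g t) a b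
  zipWith-affine p q f≡ (affine p′ q′ g≡) = piecewiseAffine-cong
    (λ t a≤t t≤b → sym (cong₂ _∙_ (f≡ t a≤t t≤b) (g≡ t a≤t t≤b)))
    (affine-∙ p q p′ q′)
  zipWith-affine p q f≡ (split c a≤c c≤b F G) = split c a≤c c≤b
    (zipWith-affine p q (λ t a≤t t≤c → f≡ t a≤t (≤-trans t≤c c≤b)) F)
    (zipWith-affine p q (λ t c≤t t≤b → f≡ t (≤-trans a≤c c≤t) t≤b) G)

  -- The interval is cut at the breakpoints of `f`, then at those of `g`, until only a pair of lines
  -- remains for `affine-∙`.
  zipWith : ∀ {f g : ℚ → ℚ} {a b} → PiecewiseAffine f a b → PiecewiseAffine g a b →
            PiecewiseAffine (λ t → f t ∙ g t) a b
  zipWith (affine p q f≡) G = zipWith-affine p q f≡ G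
  zipWith (split c a≤c c≤b F F′) G = split c a≤c c≤b
    (zipWith F (restrict ≤-refl a≤c c≤b G)) (zipWith F′ (restrict a≤c c≤b ≤-refl G))

affine-crossing : ∀ {p p′} q q′ → p < p′ → ∃[ c ]
                  ((∀ t → t ≤ c → p′ * t + q′ ≤ p * t + q) ×
                   (∀ t → c ≤ t → p * t + q ≤ p′ * t + q′))
affine-crossing {p} {p′} q q′ p<p′ = c , before , after
  where
  d = p′ - p
  0<d : 0ℚ < p′ - p
  0<d = <-linear p<p′ (≤-refl {0ℚ}) (solve (p ∷ p′ ∷ []) ℚ-ring)
  instance
    d-positive = positive 0<d
    d-nonNegative = pos⇒nonNeg d
    d-nonZero = pos⇒nonZero d
  -- The abscissa at which the two lines cross.
  c = (q - q′) * 1/ d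
  d*c : d * c ≡ q - q′
  d*c = trans (trans (*-comm d c) (*-assoc (q - q′) (1/ d) d))
              (trans (cong ((q - q′) *_) (*-inverseˡ d)) (*-identityʳ (q - q′)))
  before : ∀ t → t ≤ c → p′ * t + q′ ≤ p * t + q
  before t t≤c = ≤-linear dt≤ (≤-refl {0ℚ}) (solve (p ∷ p′ ∷ q ∷ q′ ∷ t ∷ []) ℚ-ring)
    where
    dt≤ : (p′ - p) * t ≤ q - q′
    dt≤ = subst (d * t ≤_) d*c (*-monoˡ-≤-nonNeg d t≤c)
  after : ∀ t → c ≤ t → p * t + q ≤ p′ * t + q′
  after t c≤t = ≤-linear ≤dt (≤-refl {0ℚ}) (solve (p ∷ p′ ∷ q ∷ q′ ∷ t ∷ []) ℚ-ring)
    where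
    ≤dt : q - q′ ≤ (p′ - p) * t
    ≤dt = subst (_≤ d * t) d*c (*-monoˡ-≤-nonNeg d c≤t)

-- Two lines of different slope cross once, so at most one cut is needed. Leaving `h` arbitrary lets
-- one case analysis serve both `_⊔_` and `_⊓_`.
splitByOrder-< : ∀ {h p p′} q q′ → p < p′ →
  (∀ {a b} → (∀ t → a ≤ t → t ≤ b → p * t + q ≤ p′ * t + q′) → PiecewiseAffine h a b) →
  (∀ {a b} → (∀ t → a ≤ t → t ≤ b → p′ * t + q′ ≤ p * t + q) → PiecewiseAffine h a b) →
  ∀ {a b} → PiecewiseAffine h a b
splitByOrder-< {h} q q′ p<p′ onLe onGe {a} {b} =
  let c , before , after = affine-crossing q q′ p<p′ in at c before after
  where
  at : ∀ c → (∀ t → t ≤ c → _) → (∀ t → c ≤ t → _) → PiecewiseAffine h a b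
  at c before after with ≤-total b c | ≤-total c a
  ... | inj₁ b≤c | _        = onGe λ t _ t≤b → before t (≤-trans t≤b b≤c)
  ... | inj₂ c≤b | inj₁ c≤a = onLe λ t a≤t _ → after t (≤-trans c≤a a≤t)
  ... | inj₂ c≤b | inj₂ a≤c =
    split c a≤c c≤b (onGe λ t _ t≤c → before t t≤c) (onLe λ t c≤t _ → after t c≤t)

splitByOrder : ∀ {h} p q p′ q′ →
  (∀ {a b} → (∀ t → a ≤ t → t ≤ b → p * t + q ≤ p′ * t + q′) → PiecewiseAffine h a b) →
  (∀ {a b} → (∀ t → a ≤ t → t ≤ b → p′ * t + q′ ≤ p * t + q) → PiecewiseAffine h a b) →
  ∀ {a b} → PiecewiseAffine h a b
splitByOrder p q p′ q′ onLe onGe with <-cmp p p′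
... | tri< p<p′ _ _ = splitByOrder-< q q′ p<p′ onLe onGe
... | tri> _ _ p′<p = splitByOrder-< q′ q p′<p onGe onLe
... | tri≈ _ refl _ with ≤-total q q′
...   | inj₁ q≤q′ = onLe λ t _ _ → +-monoʳ-≤ (p * t) q≤q′
...   | inj₂ q′≤q = onGe λ t _ _ → +-monoʳ-≤ (p * t) q′≤q

module _ {f g : ℚ → ℚ} {a b : ℚ} where

  ⊔-piecewiseAffine : PiecewiseAffine f a b → PiecewiseAffine g a b →
                      PiecewiseAffine (λ t → f t ⊔ g t) a b
  ⊔-piecewiseAffine = zipWith _⊔_ λ p q p′ q′ → splitByOrder p q p′ q′
    (λ le → affine p′ q′ λ t a≤t t≤b → p≤q⇒p⊔q≡q (le t a≤t t≤b))
    (λ ge → affine p q λ t a≤t t≤b → p≥q⇒p⊔q≡p (ge t a≤t t≤b))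

  ⊓-piecewiseAffine : PiecewiseAffine f a b → PiecewiseAffine g a b →
                      PiecewiseAffine (λ t → f t ⊓ g t) a b
  ⊓-piecewiseAffine = zipWith _⊓_ λ p q p′ q′ → splitByOrder p q p′ q′
    (λ le → affine p q λ t a≤t t≤b → p≤q⇒p⊓q≡p (le t a≤t t≤b))
    (λ ge → affine p′ q′ λ t a≤t t≤b → p≥q⇒p⊓q≡q (ge t a≤t t≤b))

  +-piecewiseAffine : PiecewiseAffine f a b → PiecewiseAffine g a b →
                      PiecewiseAffine (λ t → f t + g t) a b
  +-piecewiseAffine = zipWith _+_ λ p q p′ q′ →
    affine (p + p′) (q + q′) λ t _ _ → solve (p ∷ p′ ∷ q ∷ q′ ∷ t ∷ []) ℚ-ring

  -‿piecewiseAffine : PiecewiseAffine f a b → PiecewiseAffine g a b →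
                      PiecewiseAffine (λ t → f t - g t) a b
  -‿piecewiseAffine = zipWith _-_ λ p q p′ q′ →
    affine (p - p′) (q - q′) λ t _ _ → solve (p ∷ p′ ∷ q ∷ q′ ∷ t ∷ []) ℚ-ring

x≡0*t+x : ∀ t x → x ≡ 0ℚ * t + x
x≡0*t+x = solve-∀ ℚ-ring

const-piecewiseAffine : ∀ c {a b} → PiecewiseAffine (λ _ → c) a b
const-piecewiseAffine c = affine 0ℚ c λ t _ _ → x≡0*t+x t c

id-piecewiseAffine : ∀ {a b} → PiecewiseAffine (λ t → t) a b
id-piecewiseAffine = affine 1ℚ 0ℚ λ t _ _ → solve (t ∷ []) ℚ-ring

truncate-piecewiseAffine : ∀ {f a b τ} → a ≤ τ → PiecewiseAffine f a τ →
                           PiecewiseAffine (λ t → f (t ⊓ τ)) a b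
truncate-piecewiseAffine {f} {a} {b} {τ} a≤τ F with ≤-total b τ | ≤-total a b
-- The interval contains at most the point `b`, so a constant formula suffices.
... | _ | inj₂ b≤a = affine 0ℚ (f (b ⊓ τ)) λ t a≤t t≤b →
  trans (cong (λ s → f (s ⊓ τ)) (≤-antisym t≤b (≤-trans b≤a a≤t)))
        (x≡0*t+x t (f (b ⊓ τ)))
... | inj₁ b≤τ | inj₁ a≤b = piecewiseAffine-cong
  (λ t _ t≤b → cong f (sym (p≤q⇒p⊓q≡p (≤-trans t≤b b≤τ)))) (restrict ≤-refl a≤b b≤τ F)
... | inj₂ τ≤b | inj₁ _ = split τ a≤τ τ≤b
  (piecewiseAffine-cong (λ t _ t≤τ → cong f (sym (p≤q⇒p⊓q≡p t≤τ))) F)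
  (piecewiseAffine-cong (λ t τ≤t _ → cong f (sym (p≥q⇒p⊓q≡q τ≤t)))
    (const-piecewiseAffine (f τ)))

-- First zeros of piecewise affine functions

record FirstZero (f : ℚ → ℚ) (a b : ℚ) : Set where
  field
    zeroAt   : ℚ
    a≤zero   : a ≤ zeroAt
    zero≤b   : zeroAt ≤ b
    isZero   : f zeroAt ≡ 0ℚ
    positive-before : ∀ t → a ≤ t → t < zeroAt → 0ℚ < f t

-- A line positive at `a` stays positive if its slope is nonnegative or its value at `b` is
-- positive. Otherwise it decreases strictly, and its only root lies between `a` and `b`.
affine-firstZero : ∀ p q {a b} → a ≤ b → 0ℚ < p * a + q →
  FirstZero (λ t → p * t + q) a b ⊎ (∀ t → a ≤ t → t ≤ b → 0ℚ < p * t + q)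
affine-firstZero p q {a} {b} a≤b 0<fa with 0ℚ ≤? p | 0ℚ <? p * b + q
... | yes 0≤p | _ = inj₂ λ t a≤t _ → <-≤-trans 0<fa
  (+-monoˡ-≤ q (*-monoˡ-≤-nonNeg p {{nonNegative 0≤p}} a≤t))
... | no 0≰p | yes 0<fb = inj₂ λ t _ t≤b → <-≤-trans 0<fb
  (+-monoˡ-≤ q (*-monoˡ-≤-nonPos p {{nonPositive (<⇒≤ (≰⇒> 0≰p))}} t≤b))
... | no 0≰p | no 0≮fb = inj₁ record
  { zeroAt = c
  ; a≤zero = ≮⇒≥ λ c<a → <-irrefl refl (<-trans 0<fa (after c<a))
  ; zero≤b = ≮⇒≥ λ b<c → 0≮fb (before b<c)
  ; isZero = fc
  ; positive-before = λ t _ → before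
  }
  where
  instance
    p-negative = negative (≰⇒> 0≰p)
    p-nonZero = neg⇒nonZero p
  c = - q * 1/ p
  fc : p * c + q ≡ 0ℚ
  fc = trans (cong (_+ q) (trans (trans (*-comm p c) (*-assoc (- q) (1/ p) p))
                                 (trans (cong (- q *_) (*-inverseˡ p)) (*-identityʳ (- q)))))
             (+-inverseˡ q)
  before : ∀ {t} → t < c → 0ℚ < p * t + q
  before {t} t<c = subst (_< p * t + q) fc (+-monoˡ-< q (*-monoʳ-<-neg p t<c))
  after : ∀ {t} → c < t → p * t + q < 0ℚ
  after {t} c<t = subst (p * t + q <_) fc (+-monoˡ-< q (*-monoʳ-<-neg p c<t))

-- The pieces are scanned from left to right. Positivity on one piece includes its right endpoint,
-- which is the starting hypothesis for the next.
firstZero : ∀ {f a b} → PiecewiseAffine f a b → a ≤ b → 0ℚ < f a →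
            FirstZero f a b ⊎ (∀ t → a ≤ t → t ≤ b → 0ℚ < f t)
firstZero (affine p q f≡) a≤b 0<fa
  with affine-firstZero p q a≤b (subst (0ℚ <_) (f≡ _ ≤-refl a≤b) 0<fa)
... | inj₂ pos = inj₂ λ t a≤t t≤b → subst (0ℚ <_) (sym (f≡ t a≤t t≤b)) (pos t a≤t t≤b)
... | inj₁ z = inj₁ record
  { zeroAt = zeroAt
  ; a≤zero = a≤zero
  ; zero≤b = zero≤b
  ; isZero = trans (f≡ zeroAt a≤zero zero≤b) isZero
  ; positive-before = λ t a≤t t<z →
      subst (0ℚ <_) (sym (f≡ t a≤t (≤-trans (<⇒≤ t<z) zero≤b))) (positive-before t a≤t t<z)
  }
  where open FirstZero z
firstZero (split c a≤c c≤b F G) a≤b 0<fa with firstZero F a≤c 0<fa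
... | inj₁ z = inj₁ record
  { zeroAt = zeroAt ; a≤zero = a≤zero ; zero≤b = ≤-trans zero≤b c≤b
  ; isZero = isZero ; positive-before = positive-before }
  where open FirstZero z
... | inj₂ pos with firstZero G c≤b (pos c a≤c ≤-refl)
...   | inj₂ pos′ = inj₂ λ t a≤t t≤b →
  [ (λ t≤c → pos t a≤t t≤c) , (λ c≤t → pos′ t c≤t t≤b) ]′ (≤-total t c)
...   | inj₁ z = inj₁ record
  { zeroAt = zeroAt ; a≤zero = ≤-trans a≤c a≤zero ; zero≤b = zero≤b ; isZero = isZero
  ; positive-before = λ t a≤t t<z →
      [ (λ t≤c → pos t a≤t t≤c) , (λ c≤t → positive-before t c≤t t<z) ]′ (≤-total t c) }
  where open FirstZero z

-- Maxima and minima of nonempty finite families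

fold₁ : (ℚ → ℚ → ℚ) → ∀ {n} → (Fin (suc n) → ℚ) → ℚ
fold₁ _∙_ {zero}  f = f zero
fold₁ _∙_ {suc n} f = f zero ∙ fold₁ _∙_ (f ∘ suc)

fold₁-piecewiseAffine : ∀ {_∙_ a b} →
  (∀ {f g} → PiecewiseAffine f a b → PiecewiseAffine g a b →
             PiecewiseAffine (λ t → f t ∙ g t) a b) →
  ∀ {n} {F : Fin (suc n) → ℚ → ℚ} → (∀ i → PiecewiseAffine (F i) a b) →
  PiecewiseAffine (λ t → fold₁ _∙_ (λ i → F i t)) a b
fold₁-piecewiseAffine zip {zero}  pa = pa zero
fold₁-piecewiseAffine zip {suc n} pa = zip (pa zero) (fold₁-piecewiseAffine zip (pa ∘ suc))

fold₁-sel : ∀ {_∙_} → (∀ x y → x ∙ y ≡ x ⊎ x ∙ y ≡ y) →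
            ∀ {n} (f : Fin (suc n) → ℚ) → ∃[ i ] f i ≡ fold₁ _∙_ f
fold₁-sel sel {zero}  f = zero , refl
fold₁-sel {_∙_} sel {suc n} f with sel (f zero) (fold₁ _∙_ (f ∘ suc))
... | inj₁ eq = zero , sym eq
... | inj₂ eq = let i , eqᵢ = fold₁-sel sel (f ∘ suc) in suc i , trans eqᵢ (sym eq)

fold₁-⊔-isMax : ∀ {n} (f : Fin (suc n) → ℚ) → IsMax f (fold₁ _⊔_ f)
fold₁-⊔-isMax f = fold₁-sel ⊔-sel f , upper f
  where
  upper : ∀ {n} (f : Fin (suc n) → ℚ) i → f i ≤ fold₁ _⊔_ f
  upper {zero}  f zero    = ≤-refl
  upper {suc n} f zero    = p≤p⊔q (f zero) _
  upper {suc n} f (suc i) = ≤-trans (upper (f ∘ suc) i) (p≤q⊔p (f zero) _)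

fold₁-⊓-isMin : ∀ {n} (f : Fin (suc n) → ℚ) → IsMin f (fold₁ _⊓_ f)
fold₁-⊓-isMin f = fold₁-sel ⊓-sel f , lower f
  where
  lower : ∀ {n} (f : Fin (suc n) → ℚ) i → fold₁ _⊓_ f ≤ f i
  lower {zero}  f zero    = ≤-refl
  lower {suc n} f zero    = p⊓q≤p (f zero) _
  lower {suc n} f (suc i) = ≤-trans (p⊓q≤q (f zero) _) (lower (f ∘ suc) i)

-- The order of games

infix 4 _≤ᴳ?_

-- The order is defined by negations. Its decidability allows a search for an option that witnesses
-- a failure, and the removal of double negations.
_≤ᴳ?_ : ∀ G H → Dec (G ≤ᴳ H)
G@(⟨ Gᴸ ∣ _ ⟩) ≤ᴳ? H@(⟨ _ ∣ Hᴿ ⟩) =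
  all? (λ i → ¬? (H ≤ᴳ? Gᴸ i)) ×-dec all? (λ j → ¬? (Hᴿ j ≤ᴳ? G))

module _ {m n} {Gᴸ : Fin m → Game} {Gᴿ : Fin n → Game} where

  ≤ᴳ⇒≰leftOption : ∀ {H} → ⟨ Gᴸ ∣ Gᴿ ⟩ ≤ᴳ H → ∀ i → ¬ (H ≤ᴳ Gᴸ i)
  ≤ᴳ⇒≰leftOption {⟨ _ ∣ _ ⟩} = proj₁

  ≤ᴳ⇒rightOption≰ : ∀ {H} → H ≤ᴳ ⟨ Gᴸ ∣ Gᴿ ⟩ → ∀ j → ¬ (Gᴿ j ≤ᴳ H)
  ≤ᴳ⇒rightOption≰ {⟨ _ ∣ _ ⟩} = proj₂

≤ᴳ-refl : ∀ {G} → G ≤ᴳ G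
≤ᴳ-refl {⟨ Gᴸ ∣ Gᴿ ⟩} =
  (λ i G≤Gᴸᵢ → ≤ᴳ⇒≰leftOption G≤Gᴸᵢ i (≤ᴳ-refl {Gᴸ i})) ,
  (λ j Gᴿⱼ≤G → ≤ᴳ⇒rightOption≰ Gᴿⱼ≤G j (≤ᴳ-refl {Gᴿ j}))

-- If `K ≤ᴳ Gᴸ i`, then transitivity for `H`, `K`, `Gᴸ i` gives `H ≤ᴳ Gᴸ i`, against `G ≤ᴳ H`. The
-- three games rotate while one of them shrinks.
≤ᴳ-trans : ∀ {G H K} → G ≤ᴳ H → H ≤ᴳ K → G ≤ᴳ K
≤ᴳ-trans {G@(⟨ Gᴸ ∣ _ ⟩)} {H@(⟨ _ ∣ _ ⟩)} {K@(⟨ _ ∣ Kᴿ ⟩)} G≤H H≤K =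
  (λ i K≤Gᴸᵢ → proj₁ G≤H i (≤ᴳ-trans {H} {K} {Gᴸ i} H≤K K≤Gᴸᵢ)) ,
  (λ j Kᴿⱼ≤G → proj₂ H≤K j (≤ᴳ-trans {Kᴿ j} {G} {H} Kᴿⱼ≤G G≤H))

nonNegative≤suc : ∀ n → integer (+ n) ≤ᴳ integer (+ suc n)
nonNegative≤suc zero    = (λ ()) , (λ ())
nonNegative≤suc (suc n) =
  (λ _ 2+n≤n → ≤ᴳ⇒≰leftOption 2+n≤n zero (nonNegative≤suc n)) , (λ ())

negative≤suc : ∀ n → integer -[1+ n ] ≤ᴳ integer (ℤ.suc -[1+ n ])
negative≤suc zero          = (λ ()) , (λ ())
negative≤suc (suc zero)    =
  (λ ()) , (λ _ 0≤-2 → ≤ᴳ⇒rightOption≰ 0≤-2 zero (negative≤suc zero))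
negative≤suc (suc (suc n)) =
  (λ ()) , (λ _ -1-n≤-3-n → ≤ᴳ⇒rightOption≰ -1-n≤-3-n zero (negative≤suc (suc n)))

integer≤suc : ∀ n → integer n ≤ᴳ integer (ℤ.suc n)
integer≤suc (+ n)    = nonNegative≤suc n
integer≤suc -[1+ n ] = negative≤suc n

suc≰integer : ∀ n → ¬ (integer (ℤ.suc n) ≤ᴳ integer n)
suc≰integer (+ n)          1+n≤n = ≤ᴳ⇒≰leftOption 1+n≤n zero (≤ᴳ-refl {integer (+ n)})
suc≰integer -[1+ zero ]    0≤-1  = ≤ᴳ⇒rightOption≰ 0≤-1 zero (≤ᴳ-refl {integer (+ 0)})
suc≰integer -[1+ suc n ]   p     = ≤ᴳ⇒rightOption≰ p zero (≤ᴳ-refl {integer -[1+ n ]})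

integer-mono-≤ : ∀ {m n} → m ℤ.≤ n → integer m ≤ᴳ integer n
integer-mono-≤ (ℤ.+≤+ m≤n) = ascend (ℕ.≤⇒≤′ m≤n)
  where
  ascend : ∀ {m n} → m ℕ.≤′ n → integer (+ m) ≤ᴳ integer (+ n)
  ascend {m} {n} (ℕ.≤′-reflexive refl) = ≤ᴳ-refl {integer (+ n)}
  ascend {m} {suc n} (ℕ.≤′-step m≤n)  =
    ≤ᴳ-trans {integer (+ m)} {integer (+ n)} {integer (+ suc n)} (ascend m≤n) (integer≤suc (+ n))
integer-mono-≤ (ℤ.-≤- n≤m) = descend (ℕ.≤⇒≤′ n≤m)
  where
  descend : ∀ {m n} → n ℕ.≤′ m → integer -[1+ m ] ≤ᴳ integer -[1+ n ]
  descend {m} (ℕ.≤′-reflexive refl) = ≤ᴳ-refl {integer -[1+ m ]}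
  descend {suc m} {n} (ℕ.≤′-step n≤m)  =
    ≤ᴳ-trans {integer -[1+ suc m ]} {integer -[1+ m ]} {integer -[1+ n ]}
      (integer≤suc -[1+ suc m ]) (descend n≤m)
integer-mono-≤ {n = + n} (ℤ.-≤+ {m}) =
  ≤ᴳ-trans {integer -[1+ m ]} {integer (+ 0)} {integer (+ n)}
    (negative≤0 m) (integer-mono-≤ (ℤ.+≤+ z≤n))
  where
  negative≤0 : ∀ m → integer -[1+ m ] ≤ᴳ integer (+ 0)
  negative≤0 zero    = (λ ()) , (λ ())
  negative≤0 (suc m) = (λ ()) , (λ ())

integer-cancel-≤ : ∀ {m n} → integer m ≤ᴳ integer n → m ℤ.≤ n
integer-cancel-≤ {m} {n} m≤n = ℤ.≮⇒≥ λ n<m → suc≰integer n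
  (≤ᴳ-trans {integer (ℤ.suc n)} {integer m} {integer n}
    (integer-mono-≤ (ℤ.i<j⇒suc[i]≤j n<m)) m≤n)

module _ {m n} {Gᴸ : Fin m → Game} {Gᴿ : Fin n → Game} where

  private
    G : Game
    G = ⟨ Gᴸ ∣ Gᴿ ⟩

  private
    Separates : ℤ → Set
    Separates k = (∀ i → ¬ (integer k ≤ᴳ Gᴸ i)) × (∀ j → ¬ (Gᴿ j ≤ᴳ integer k))

  -- Walk from k towards 0 as long as the next integer still separates the options.
  simplestNonNegative : ∀ k → Separates (+ k) → ∃[ n ] G ≈ᴳ integer n
  simplestNonNegative zero (k≰Gᴸ , Gᴿ≰k) = + zero , (k≰Gᴸ , λ ()) , ((λ ()) , Gᴿ≰k)
  simplestNonNegative (suc k) (k≰Gᴸ , Gᴿ≰k) with any? (λ i → integer (+ k) ≤ᴳ? Gᴸ i)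
  -- The option `Gᴸ i` refutes `G ≤ᴳ integer (+ k)`, which is what the only Left option of
  -- `integer (+ suc k)` demands.
  ... | yes (i , k≤Gᴸᵢ) = + suc k , (k≰Gᴸ , λ ()) ,
    ((λ _ G≤k → ≤ᴳ⇒≰leftOption {Gᴸ = Gᴸ} {Gᴿ} G≤k i k≤Gᴸᵢ) , Gᴿ≰k)
  ... | no k≰ = simplestNonNegative k
    ( (λ i k≤Gᴸᵢ → k≰ (i , k≤Gᴸᵢ))
    , λ j Gᴿⱼ≤k → Gᴿ≰k j
        (≤ᴳ-trans {Gᴿ j} {integer (+ k)} {integer (+ suc k)} Gᴿⱼ≤k (nonNegative≤suc k)))

  simplestNegative : ∀ k → Separates -[1+ k ] → ∃[ n ] G ≈ᴳ integer n
  simplestNegative zero (k≰Gᴸ , Gᴿ≰k) with any? (λ j → Gᴿ j ≤ᴳ? integer (+ 0))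
  ... | yes (j , Gᴿⱼ≤k) = -[1+ zero ] ,
    (k≰Gᴸ , λ _ k≤G → ≤ᴳ⇒rightOption≰ {Gᴸ = Gᴸ} {Gᴿ} k≤G j Gᴿⱼ≤k) , ((λ ()) , Gᴿ≰k)
  ... | no ≰k = simplestNonNegative zero
    ( (λ i k≤Gᴸᵢ → k≰Gᴸ i
        (≤ᴳ-trans {integer -[1+ 0 ]} {integer (+ 0)} {Gᴸ i} (negative≤suc 0) k≤Gᴸᵢ))
    , λ j Gᴿⱼ≤k → ≰k (j , Gᴿⱼ≤k))
  simplestNegative (suc k) (k≰Gᴸ , Gᴿ≰k) with any? (λ j → Gᴿ j ≤ᴳ? integer -[1+ k ])
  ... | yes (j , Gᴿⱼ≤k) = -[1+ suc k ] ,
    (k≰Gᴸ , λ _ k≤G → ≤ᴳ⇒rightOption≰ {Gᴸ = Gᴸ} {Gᴿ} k≤G j Gᴿⱼ≤k) , ((λ ()) , Gᴿ≰k)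
  ... | no ≰k = simplestNegative k
    ( (λ i k≤Gᴸᵢ → k≰Gᴸ i
        (≤ᴳ-trans {integer -[1+ suc k ]} {integer -[1+ k ]} {Gᴸ i} (negative≤suc (suc k)) k≤Gᴸᵢ))
    , λ j Gᴿⱼ≤k → ≰k (j , Gᴿⱼ≤k))

  simplestInteger : ∀ k → Separates k → ∃[ n ] G ≈ᴳ integer n
  simplestInteger (+ k)    = simplestNonNegative k
  simplestInteger -[1+ k ] = simplestNegative k

  -- With no Left option reaching `k`, the order can only fail through a Right option of `integer k`
  -- that is at most `G`. The canonical form has one only for negative `k`, namely `k + 1`.
  ≰integer⇒suc≤ : ∀ k → (∀ i → ¬ (integer k ≤ᴳ Gᴸ i)) → ¬ (G ≤ᴳ integer k) →
                  integer (ℤ.suc k) ≤ᴳ G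
  ≰integer⇒suc≤ (+ zero)     k≰Gᴸ G≰k = contradiction (k≰Gᴸ , λ ()) G≰k
  ≰integer⇒suc≤ (+ suc k)    k≰Gᴸ G≰k = contradiction (k≰Gᴸ , λ ()) G≰k
  ≰integer⇒suc≤ -[1+ zero ]  k≰Gᴸ G≰k =
    decidable-stable (integer (+ 0) ≤ᴳ? G) λ ≰ → G≰k (k≰Gᴸ , λ _ → ≰)
  ≰integer⇒suc≤ -[1+ suc k ] k≰Gᴸ G≰k =
    decidable-stable (integer -[1+ k ] ≤ᴳ? G) λ ≰ → G≰k (k≰Gᴸ , λ _ → ≰)

  integer≰⇒≤pred : ∀ k → (∀ j → ¬ (Gᴿ j ≤ᴳ integer k)) → ¬ (integer k ≤ᴳ G) →
                   G ≤ᴳ integer (ℤ.pred k)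
  integer≰⇒≤pred (+ zero)     Gᴿ≰k k≰G = contradiction ((λ ()) , Gᴿ≰k) k≰G
  integer≰⇒≤pred (+ suc k)    Gᴿ≰k k≰G =
    decidable-stable (G ≤ᴳ? integer (+ k)) λ ≰ → k≰G ((λ _ → ≰) , Gᴿ≰k)
  integer≰⇒≤pred -[1+ zero ]  Gᴿ≰k k≰G = contradiction ((λ ()) , Gᴿ≰k) k≰G
  integer≰⇒≤pred -[1+ suc k ] Gᴿ≰k k≰G = contradiction ((λ ()) , Gᴿ≰k) k≰G

-- Existence of thermographs

-- If G ≰ k, then Left moving first secures k in G at the price t of that move: this is
-- the + t in ≰integer⇒≤leftWall.
record Regular (G : Game) (T : Thermograph) : Set where
  field
    isThermograph : IsThermographOf G T
    -1≤temperature : - 1ℚ ≤ temperature T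
    walls-meet : leftWall T (temperature T) ≡ rightWall T (temperature T)
    leftWall-piecewiseAffine  : ∀ {b} → PiecewiseAffine (leftWall T) (- 1ℚ) b
    rightWall-piecewiseAffine : ∀ {b} → PiecewiseAffine (rightWall T) (- 1ℚ) b
    eventually : ∃[ b ] (∀ t → b ≤ t → rightWall T t ≤ t × - t ≤ leftWall T t)
    integer≤⇒≤rightWall : ∀ k t → - 1ℚ ≤ t → integer k ≤ᴳ G → k / 1 ≤ rightWall T t
    ≤integer⇒leftWall≤  : ∀ k t → - 1ℚ ≤ t → G ≤ᴳ integer k → leftWall T t ≤ k / 1
    ≰integer⇒≤leftWall  : ∀ k t → - 1ℚ ≤ t → ¬ (G ≤ᴳ integer k) → k / 1 ≤ leftWall T t + t
    integer≰⇒rightWall≤ : ∀ k t → - 1ℚ ≤ t → ¬ (integer k ≤ᴳ G) → rightWall T t - t ≤ k / 1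

≤⇒<∨≡ : ∀ {x y} → x ≤ y → x < y ⊎ x ≡ y
≤⇒<∨≡ {x} {y} x≤y with x <? y
... | yes x<y = inj₁ x<y
... | no x≮y  = inj₂ (≤-antisym x≤y (≮⇒≥ x≮y))

-- Here `x ⊔ - x` plays the absolute value; it supplies the bounds for `eventually`.
x≤x⊔-x : ∀ x → x ≤ x ⊔ - x
x≤x⊔-x x = p≤p⊔q x (- x)

x⊔-x≤y⇒-y≤x : ∀ {x y} → x ⊔ - x ≤ y → - y ≤ x
x⊔-x≤y⇒-y≤x {x} {y} ∣x∣≤y = subst (- y ≤_) (lemma x) (neg-antimono-≤ (p⊔q≤r⇒q≤r x (- x) ∣x∣≤y))
  where
  lemma : ∀ x → - (- x) ≡ x
  lemma = solve-∀ ℚ-ring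

regular-integer : ∀ {G} → ∃[ n ] G ≈ᴳ integer n → ∃ (Regular G)
regular-integer {G} (n , G≈n@(G≤n , n≤G)) = _ , record
  { isThermograph = mast n G≈n
  ; -1≤temperature = ≤-refl
  ; walls-meet = refl
  ; leftWall-piecewiseAffine = const-piecewiseAffine (n / 1)
  ; rightWall-piecewiseAffine = const-piecewiseAffine (n / 1)
  ; eventually = n / 1 ⊔ - (n / 1) , λ t b≤t → ≤-trans (x≤x⊔-x (n / 1)) b≤t , x⊔-x≤y⇒-y≤x b≤t
  ; integer≤⇒≤rightWall = λ k _ _ k≤G →
      /1-mono-≤ (integer-cancel-≤ (≤ᴳ-trans {integer k} {G} {integer n} k≤G G≤n))
  ; ≤integer⇒leftWall≤ = λ k _ _ G≤k →
      /1-mono-≤ (integer-cancel-≤ (≤ᴳ-trans {integer n} {G} {integer k} n≤G G≤k))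
  -- By integrality `k + 1 ≤ n`, and the extra 1 compensates for `t` as low as -1.
  ; ≰integer⇒≤leftWall = λ k t -1≤t G≰k → ≤-linear
      (suc≤ k n (λ n≤k → G≰k (≤ᴳ-trans {G} {integer n} {integer k} G≤n (integer-mono-≤ n≤k))))
      -1≤t (shift (k / 1) (n / 1) t)
  ; integer≰⇒rightWall≤ = λ k t -1≤t k≰G → ≤-linear
      (suc≤ n k (λ k≤n → k≰G (≤ᴳ-trans {integer k} {integer n} {G} (integer-mono-≤ k≤n) n≤G)))
      -1≤t (shift′ (n / 1) (k / 1) t)
  }
  where
  suc≤ : ∀ m n → ¬ (n ℤ.≤ m) → m / 1 + 1ℚ ≤ n / 1
  suc≤ m n n≰m = subst (_≤ n / 1) (/1-suc m) (/1-mono-≤ (ℤ.i<j⇒suc[i]≤j (ℤ.≰⇒> n≰m)))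
  shift : ∀ x y t → x + (y + t) ≡ y + t + ((x + 1ℚ) + - 1ℚ)
  shift = solve-∀ ℚ-ring
  shift′ : ∀ x y t → x - t + (y + t) ≡ y + ((x + 1ℚ) + - 1ℚ)
  shift′ = solve-∀ ℚ-ring

module LeftScaffold {m} {Gᴸ : Fin (suc m) → Game} {Tᴸ : Fin (suc m) → Thermograph}
                    (Rᴸ : ∀ i → Regular (Gᴸ i) (Tᴸ i)) where

  left : ℚ → ℚ
  left t = fold₁ _⊔_ λ i → rightWall (Tᴸ i) t - t

  left-isMax : ∀ t → IsMax (λ i → rightWall (Tᴸ i) t - t) (left t)
  left-isMax t = fold₁-⊔-isMax _

  left-piecewiseAffine : ∀ {b} → PiecewiseAffine left (- 1ℚ) b
  left-piecewiseAffine = fold₁-piecewiseAffine ⊔-piecewiseAffine λ i →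
    -‿piecewiseAffine (Regular.rightWall-piecewiseAffine (Rᴸ i)) id-piecewiseAffine

  left-lub : ∀ {t x} → (∀ i → rightWall (Tᴸ i) t - t ≤ x) → left t ≤ x
  left-lub {t} {x} bound = let i , eq = proj₁ (left-isMax t) in subst (_≤ x) eq (bound i)

  -- Once `t` exceeds every option's right wall, subtracting `t` leaves nothing positive. With
  -- `right-eventually` this forces the scaffolds to meet.
  left-eventually : ∃[ b ] (∀ t → b ≤ t → left t ≤ 0ℚ)
  left-eventually = fold₁ _⊔_ bound , λ t b≤t → left-lub λ i →
    subst (rightWall (Tᴸ i) t - t ≤_) (+-inverseʳ t)
      (+-monoˡ-≤ (- t) (proj₁ (proj₂ (Regular.eventually (Rᴸ i)) t
        (≤-trans (proj₂ (fold₁-⊔-isMax bound) i) b≤t))))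
    where
    bound : Fin (suc m) → ℚ
    bound i = proj₁ (Regular.eventually (Rᴸ i))

  -- At `t = -1` the scaffold lies at least 1 above every right wall, so an option at least
  -- `floor x` would lift it to `floor x + 1`, beyond `x`.
  floor≰leftOption : ∀ {x} → left (- 1ℚ) ≤ x → ∀ i → ¬ (integer (floor x) ≤ᴳ Gᴸ i)
  floor≰leftOption {x} left≤x i x≤Gᴸᵢ = <-irrefl refl (<-≤-trans (<-floor+1 x)
    (≤-trans (+-monoˡ-≤ 1ℚ (Regular.integer≤⇒≤rightWall (Rᴸ i) (floor x) (- 1ℚ) ≤-refl x≤Gᴸᵢ))
             (≤-trans (proj₂ (left-isMax (- 1ℚ)) i) left≤x)))

module RightScaffold {n} {Gᴿ : Fin (suc n) → Game} {Tᴿ : Fin (suc n) → Thermograph}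
                     (Rᴿ : ∀ j → Regular (Gᴿ j) (Tᴿ j)) where

  right : ℚ → ℚ
  right t = fold₁ _⊓_ λ j → leftWall (Tᴿ j) t + t

  right-isMin : ∀ t → IsMin (λ j → leftWall (Tᴿ j) t + t) (right t)
  right-isMin t = fold₁-⊓-isMin _

  right-piecewiseAffine : ∀ {b} → PiecewiseAffine right (- 1ℚ) b
  right-piecewiseAffine = fold₁-piecewiseAffine ⊓-piecewiseAffine λ j →
    +-piecewiseAffine (Regular.leftWall-piecewiseAffine (Rᴿ j)) id-piecewiseAffine

  right-glb : ∀ {t x} → (∀ j → x ≤ leftWall (Tᴿ j) t + t) → x ≤ right t
  right-glb {t} {x} bound = let j , eq = proj₁ (right-isMin t) in subst (x ≤_) eq (bound j)

  right-eventually : ∃[ b ] (∀ t → b ≤ t → 0ℚ ≤ right t)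
  right-eventually = fold₁ _⊔_ bound , λ t b≤t → right-glb λ j →
    subst (_≤ leftWall (Tᴿ j) t + t) (+-inverseˡ t)
      (+-monoˡ-≤ t (proj₂ (proj₂ (Regular.eventually (Rᴿ j)) t
        (≤-trans (proj₂ (fold₁-⊔-isMax bound) j) b≤t))))
    where
    bound : Fin (suc n) → ℚ
    bound j = proj₁ (Regular.eventually (Rᴿ j))

  -- An option at most `floor x` would pull the scaffold at -1 down to `x - 1`. So if
  -- `left (- 1ℚ) ≤ right (- 1ℚ)`, the integer `floor (left (- 1ℚ))` separates both families of
  -- options.
  rightOption≰floor : ∀ {x} → x ≤ right (- 1ℚ) → ∀ j → ¬ (Gᴿ j ≤ᴳ integer (floor x))
  rightOption≰floor {x} x≤right j Gᴿⱼ≤x = <-irrefl refl (<-≤-trans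
    (subst (x - 1ℚ <_) (+-identityʳ x) (+-monoʳ-< x -1<0))
    (≤-trans (≤-trans x≤right (proj₂ (right-isMin (- 1ℚ)) j))
      (+-monoˡ-≤ (- 1ℚ) (≤-trans (Regular.≤integer⇒leftWall≤ (Rᴿ j) (floor x) (- 1ℚ) ≤-refl Gᴿⱼ≤x)
                                 (floor-≤ x)))))
    where
    -1<0 : - 1ℚ < 0ℚ
    -1<0 = negative⁻¹ (- 1ℚ)

module Scaffolds {m n} {Gᴸ : Fin (suc m) → Game} {Gᴿ : Fin (suc n) → Game}
                 {Tᴸ : Fin (suc m) → Thermograph} {Tᴿ : Fin (suc n) → Thermograph}
                 (Rᴸ : ∀ i → Regular (Gᴸ i) (Tᴸ i)) (Rᴿ : ∀ j → Regular (Gᴿ j) (Tᴿ j)) where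

  open LeftScaffold Rᴸ
  open RightScaffold Rᴿ

  G : Game
  G = ⟨ Gᴸ ∣ Gᴿ ⟩

  difference : ℚ → ℚ
  difference t = left t - right t

  0<difference⇒< : ∀ {t} → 0ℚ < difference t → right t < left t
  0<difference⇒< {t} 0<d = <-linear 0<d (≤-refl {0ℚ}) (lemma (left t) (right t))
    where
    lemma : ∀ x y → y + (x - y + 0ℚ) ≡ x + (0ℚ + 0ℚ)
    lemma = solve-∀ ℚ-ring

  difference≡0⇒≡ : ∀ {t} → difference t ≡ 0ℚ → left t ≡ right t
  difference≡0⇒≡ {t} d≡0 = trans (lemma (left t) (right t))
    (trans (cong (_+ right t) d≡0) (+-identityˡ (right t)))
    where
    lemma : ∀ x y → x ≡ x - y + y
    lemma = solve-∀ ℚ-ring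

  module _ (right<left : right (- 1ℚ) < left (- 1ℚ)) where

    -- If `G` equalled `k`, no Left option would be at least `k` and no Right option at most `k`.
    -- The walls of the options would then give `left (- 1ℚ) ≤ k / 1 ≤ right (- 1ℚ)`.
    notInteger : ∀ k → ¬ (G ≈ᴳ integer k)
    notInteger k (G≤k , k≤G) = <-irrefl refl (<-≤-trans right<left (≤-trans
      (left-lub λ i → Regular.integer≰⇒rightWall≤ (Rᴸ i) k (- 1ℚ) ≤-refl
        (≤ᴳ⇒≰leftOption {Gᴸ = Gᴸ} {Gᴿ} G≤k i))
      (right-glb λ j → Regular.≰integer⇒≤leftWall (Rᴿ j) k (- 1ℚ) ≤-refl
        (≤ᴳ⇒rightOption≰ {Gᴸ = Gᴸ} {Gᴿ} k≤G j))))

    meeting : ∃[ b ] FirstZero difference (- 1ℚ) b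
    meeting = b , [ (λ z → z) , (λ pos → contradiction (<-≤-trans (pos b -1≤b ≤-refl) difference≤0)
                                           (<-irrefl refl)) ]′
      (firstZero (-‿piecewiseAffine left-piecewiseAffine right-piecewiseAffine) -1≤b
        (<-linear right<left (≤-refl {0ℚ}) (lemma (left (- 1ℚ)) (right (- 1ℚ)))))
      where
      bᴸ = proj₁ left-eventually
      bᴿ = proj₁ right-eventually
      -- Here `left` is at most 0 and `right` at least 0, so the difference cannot stay positive up
      -- to `b`.
      b = - 1ℚ ⊔ (bᴸ ⊔ bᴿ)
      -1≤b : - 1ℚ ≤ b
      -1≤b = p≤p⊔q (- 1ℚ) (bᴸ ⊔ bᴿ)
      bᴸ⊔bᴿ≤b : bᴸ ⊔ bᴿ ≤ b
      bᴸ⊔bᴿ≤b = p≤q⊔p (- 1ℚ) (bᴸ ⊔ bᴿ)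
      lemma : ∀ x y → 0ℚ + (x + 0ℚ) ≡ x - y + (y + 0ℚ)
      lemma = solve-∀ ℚ-ring
      lemma′ : ∀ x y → x - y + (0ℚ + y) ≡ 0ℚ + (x + 0ℚ)
      lemma′ = solve-∀ ℚ-ring
      difference≤0 : difference b ≤ 0ℚ
      difference≤0 = ≤-linear
        (proj₂ left-eventually b (≤-trans (p≤p⊔q bᴸ bᴿ) bᴸ⊔bᴿ≤b))
        (proj₂ right-eventually b (≤-trans (p≤q⊔p bᴸ bᴿ) bᴸ⊔bᴿ≤b))
        (lemma′ (left b) (right b))

  module AtMeeting (right<left : right (- 1ℚ) < left (- 1ℚ))
                   {b} (z : FirstZero difference (- 1ℚ) b) where

    open FirstZero z renaming (zeroAt to τ; a≤zero to -1≤τ)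

    left≡right : left τ ≡ right τ
    left≡right = difference≡0⇒≡ isZero

    isLeastMeeting : IsLeastMeeting left right τ
    isLeastMeeting = -1≤τ , left≡right , λ t -1≤t l≡r → ≮⇒≥ λ t<τ →
      <-irrefl (sym l≡r) (0<difference⇒< (positive-before t -1≤t t<τ))

    right≤left-below : ∀ {s} → - 1ℚ ≤ s → s ≤ τ → right s ≤ left s
    right≤left-below {s} -1≤s s≤τ =
      [ (λ s<τ → <⇒≤ (0<difference⇒< (positive-before s -1≤s s<τ)))
      , (λ s≡τ → ≤-reflexive (subst (λ u → right u ≡ left u) (sym s≡τ) (sym left≡right)))
      ]′ (≤⇒<∨≡ s≤τ)

    meetingThermograph : Thermograph
    meetingThermograph = record
      { leftWall    = λ t → left (t ⊓ τ)
      ; rightWall   = λ t → right (t ⊓ τ)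
      ; temperature = τ
      }

    -1≤⊓τ : ∀ {t} → - 1ℚ ≤ t → - 1ℚ ≤ t ⊓ τ
    -1≤⊓τ -1≤t = ⊓-glb -1≤t -1≤τ

    walls-ordered : ∀ t → - 1ℚ ≤ t → right (t ⊓ τ) ≤ left (t ⊓ τ)
    walls-ordered t -1≤t = right≤left-below (-1≤⊓τ -1≤t) (p⊓q≤q t τ)

    -- No Right option is at most `k`, and the tax in `≰integer⇒≤leftWall` for these options is
    -- exactly the one the right scaffold adds.
    integer≤⇒≤right : ∀ k t → - 1ℚ ≤ t → integer k ≤ᴳ G → k / 1 ≤ right (t ⊓ τ)
    integer≤⇒≤right k t -1≤t k≤G = right-glb λ j →
      Regular.≰integer⇒≤leftWall (Rᴿ j) k (t ⊓ τ) (-1≤⊓τ -1≤t)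
        (≤ᴳ⇒rightOption≰ {Gᴸ = Gᴸ} {Gᴿ} k≤G j)

    ≤integer⇒left≤ : ∀ k t → - 1ℚ ≤ t → G ≤ᴳ integer k → left (t ⊓ τ) ≤ k / 1
    ≤integer⇒left≤ k t -1≤t G≤k = left-lub λ i →
      Regular.integer≰⇒rightWall≤ (Rᴸ i) k (t ⊓ τ) (-1≤⊓τ -1≤t)
        (≤ᴳ⇒≰leftOption {Gᴸ = Gᴸ} {Gᴿ} G≤k i)

    ≰integer⇒≤left : ∀ k t → - 1ℚ ≤ t → ¬ (G ≤ᴳ integer k) → k / 1 ≤ left (t ⊓ τ) + t
    ≰integer⇒≤left k t -1≤t G≰k with any? (λ i → integer k ≤ᴳ? Gᴸ i)
    -- Moving to this option puts the left scaffold at `k - s` or higher, where `s ≤ t`.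
    ... | yes (i , k≤Gᴸᵢ) = ≤-linear
      (≤-trans (+-monoˡ-≤ (- s) (Regular.integer≤⇒≤rightWall (Rᴸ i) k s (-1≤⊓τ -1≤t) k≤Gᴸᵢ))
               (proj₂ (left-isMax s) i))
      (p⊓q≤p t τ) (lemma (k / 1) (left s) s t)
      where
      s = t ⊓ τ
      lemma : ∀ x y s t → x + (y + t) ≡ y + t + ((x - s) + s)
      lemma = solve-∀ ℚ-ring
    -- Now `k + 1` is at most `G`, hence at most the right wall and so the left wall; the extra 1
    -- again covers `t ≥ -1`.
    ... | no k≰Gᴸ = ≤-linear
      (≤-trans (subst (_≤ right s) (/1-suc k) (integer≤⇒≤right (ℤ.suc k) t -1≤t
                 (≰integer⇒suc≤ k (λ i k≤Gᴸᵢ → k≰Gᴸ (i , k≤Gᴸᵢ)) G≰k)))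
               (walls-ordered t -1≤t))
      -1≤t (lemma (k / 1) (left s) t)
      where
      s = t ⊓ τ
      lemma : ∀ x y t → x + (y + t) ≡ y + t + ((x + 1ℚ) + - 1ℚ)
      lemma = solve-∀ ℚ-ring

    integer≰⇒right≤ : ∀ k t → - 1ℚ ≤ t → ¬ (integer k ≤ᴳ G) → right (t ⊓ τ) - t ≤ k / 1
    integer≰⇒right≤ k t -1≤t k≰G with any? (λ j → Gᴿ j ≤ᴳ? integer k)
    ... | yes (j , Gᴿⱼ≤k) = ≤-linear
      (≤-trans (proj₂ (right-isMin s) j)
               (+-monoˡ-≤ s (Regular.≤integer⇒leftWall≤ (Rᴿ j) k s (-1≤⊓τ -1≤t) Gᴿⱼ≤k)))
      (p⊓q≤p t τ) (lemma (k / 1) (right s) s t)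
      where
      s = t ⊓ τ
      lemma : ∀ x y s t → y - t + ((x + s) + t) ≡ x + (y + s)
      lemma = solve-∀ ℚ-ring
    ... | no Gᴿ≰k = ≤-linear
      (≤-trans (walls-ordered t -1≤t) (≤integer⇒left≤ (ℤ.pred k) t -1≤t
                 (integer≰⇒≤pred k (λ j Gᴿⱼ≤k → Gᴿ≰k (j , Gᴿⱼ≤k)) k≰G)))
      -1≤t (trans (cong (λ x → right s - t + (x + t)) (/1-homo-+ (-[1+ 0 ]) k))
                  (lemma (k / 1) (right s) t))
      where
      s = t ⊓ τ
      lemma : ∀ x y t → y - t + (- 1ℚ + x + t) ≡ x + (y + - 1ℚ)
      lemma = solve-∀ ℚ-ring

    regular : Regular G meetingThermograph
    regular = record
      { isThermograph = scaffolds Tᴸ Tᴿ left right τ (notInteger right<left)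
          (λ i → Regular.isThermograph (Rᴸ i)) (λ j → Regular.isThermograph (Rᴿ j))
          left-isMax right-isMin isLeastMeeting
      ; -1≤temperature = -1≤τ
      ; walls-meet = subst (λ s → left s ≡ right s) (sym (⊓-idem τ)) left≡right
      ; leftWall-piecewiseAffine = truncate-piecewiseAffine -1≤τ left-piecewiseAffine
      ; rightWall-piecewiseAffine = truncate-piecewiseAffine -1≤τ right-piecewiseAffine
      -- From `τ` on both walls are the mast at `left τ`, so it is enough to exceed its absolute
      -- value.
      ; eventually = τ ⊔ (left τ ⊔ - left τ) , λ t b≤t →
          let τ≤t    = ≤-trans (p≤p⊔q τ _) b≤t
              ∣l∣≤t  = ≤-trans (p≤q⊔p τ _) b≤t
              τ≡t⊓τ  = sym (p≥q⇒p⊓q≡q τ≤t)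
          in subst (λ s → right s ≤ t) τ≡t⊓τ
               (subst (_≤ t) left≡right (≤-trans (x≤x⊔-x (left τ)) ∣l∣≤t))
           , subst (λ s → - t ≤ left s) τ≡t⊓τ (x⊔-x≤y⇒-y≤x ∣l∣≤t)
      ; integer≤⇒≤rightWall = integer≤⇒≤right
      ; ≤integer⇒leftWall≤ = ≤integer⇒left≤
      ; ≰integer⇒≤leftWall = ≰integer⇒≤left
      ; integer≰⇒rightWall≤ = integer≰⇒right≤
      }

  regularThermograph : ∃ (Regular G)
  regularThermograph with right (- 1ℚ) <? left (- 1ℚ)
  ... | yes right<left = _ , AtMeeting.regular right<left (proj₂ (meeting right<left))
  ... | no right≮left = regular-integer (simplestInteger {Gᴸ = Gᴸ} {Gᴿ} (floor (left (- 1ℚ)))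
    (floor≰leftOption ≤-refl , rightOption≰floor (≮⇒≥ right≮left)))

regularThermograph : ∀ G → ∃ (Regular G)
regularThermograph (⟨_∣_⟩ {zero} {zero} Gᴸ Gᴿ) =
  regular-integer (simplestInteger {Gᴸ = Gᴸ} {Gᴿ} (+ 0) ((λ ()) , λ ()))
-- Only one scaffold exists, and an integer is needed on one side of it only.
regularThermograph (⟨_∣_⟩ {zero} {suc n} Gᴸ Gᴿ) =
  regular-integer (simplestInteger {Gᴸ = Gᴸ} {Gᴿ} (floor (right (- 1ℚ)))
    ((λ ()) , rightOption≰floor ≤-refl))
  where open RightScaffold (λ j → proj₂ (regularThermograph (Gᴿ j)))
regularThermograph (⟨_∣_⟩ {suc m} {zero} Gᴸ Gᴿ) =
  regular-integer (simplestInteger {Gᴸ = Gᴸ} {Gᴿ} (floor (left (- 1ℚ)))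
    (floor≰leftOption ≤-refl , λ ()))
  where open LeftScaffold (λ i → proj₂ (regularThermograph (Gᴸ i)))
regularThermograph (⟨_∣_⟩ {suc m} {suc n} Gᴸ Gᴿ) = Scaffolds.regularThermograph
  (λ i → proj₂ (regularThermograph (Gᴸ i))) (λ j → proj₂ (regularThermograph (Gᴿ j)))

-- At the temperature `τ` both walls have the same value `v`. The hypotheses give `k ≤ v + τ` and
-- `v - τ ≤ - k`, which add up to `2k ≤ 2τ`.
temperature≥ : ∀ {G T} → Regular G T → ∀ k →
               ¬ (G ≤ᴳ integer k) → ¬ (integer (ℤ.- k) ≤ᴳ G) → k / 1 ≤ temperature T
temperature≥ {G} {T} R k G≰k -k≰G = ≮⇒≥ λ τ<k → <-irrefl refl (<-≤-trans (+-mono-< τ<k τ<k)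
  (≤-linear
    (≰integer⇒≤leftWall k τ -1≤temperature G≰k)
    (subst₂ _≤_ (cong (_- τ) (sym walls-meet)) (/1-homo-neg k)
      (integer≰⇒rightWall≤ (ℤ.- k) τ -1≤temperature -k≰G))
    (lemma (k / 1) (leftWall T τ) τ)))
  where
  open Regular R
  τ = temperature T
  lemma : ∀ k l t → k + k + (l + t + - k) ≡ t + t + (k + (l - t))
  lemma = solve-∀ ℚ-ring

-- The strategy on one pair of hubs

-- Vertices 0 and 1 are the hubs, each joined to the three leaves of its parity.
isHub : Fin 8 → Bool
isHub x = toℕ x <ᵇ 2

joined : Fin 8 → Fin 8 → Bool
joined x y = (isHub x xor isHub y) ∧ (toℕ x % 2 ≡ᵇ toℕ y % 2)

State : Set
State = Vec (Maybe Player) 8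

module _ (p : Player) where

  -- The player p owns the centre.
  LegalIn : Player → State → Fin 8 → Set
  LegalIn q s x = lookup s x ≡ nothing × (T (isHub x) → p ≢ opponent q)
                × (∀ y → T (joined x y) → lookup s y ≢ just (opponent q))

  legalIn? : ∀ q s x → Dec (LegalIn q s x)
  legalIn? q s x = ≡-dec _≟ᴾ_ (lookup s x) nothing ×-dec (T? (isHub x) →-dec ¬? (p ≟ᴾ opponent q))
    ×-dec all? (λ y → T? (joined x y) →-dec ¬? (≡-dec _≟ᴾ_ (lookup s y) (just (opponent q))))

  -- SecuredIn n k s: moving second, p can hold on to k spare moves in s within n further
  -- moves of either player.  MovesTo n k s: p can move to such a state.
  SecuredIn MovesTo : ℕ → ℕ → State → Set

  -- This mirrors the Left option `k` of `integer (+ suc k)`: one spare move can be spent while the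
  -- other `k` are kept.
  Tempo : ℕ → ℕ → State → Set
  Tempo n zero    s = ⊤
  Tempo n (suc k) s = MovesTo n k s

  Replies : ℕ → ℕ → State → Set
  -- With the budget spent no answer is possible, so the opponent must have no move left here.
  Replies zero    k s = ∀ x → ¬ LegalIn (opponent p) s x
  Replies (suc n) k s = ∀ x → LegalIn (opponent p) s x → MovesTo n k (s [ x ]≔ just (opponent p))

  SecuredIn n k s = Tempo n k s × Replies n k s

  MovesTo zero    k s = ⊥
  MovesTo (suc n) k s = ∃[ x ] (LegalIn p s x × SecuredIn n k (s [ x ]≔ just p))

  securedIn? : ∀ n k s → Dec (SecuredIn n k s)
  movesTo? : ∀ n k s → Dec (MovesTo n k s)

  tempo? : ∀ n k s → Dec (Tempo n k s)
  tempo? n zero    s = yes tt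
  tempo? n (suc k) s = movesTo? n k s

  replies? : ∀ n k s → Dec (Replies n k s)
  replies? zero    k s = all? λ x → ¬? (legalIn? (opponent p) s x)
  replies? (suc n) k s = all? λ x → legalIn? (opponent p) s x →-dec movesTo? n k _

  securedIn? n k s = tempo? n k s ×-dec replies? n k s

  movesTo? zero    k s = no λ ()
  movesTo? (suc n) k s = any? λ x → legalIn? p s x ×-dec securedIn? n k _

fresh : State
fresh = replicate 8 nothing

-- A finite search settles this. The budget 8 is the number of vertices of a pair, and 3 counts the
-- leaves reserved by the hub that `p` takes.
secured-fresh : ∀ p → SecuredIn p 8 3 fresh
secured-fresh Left  = toWitness {a? = securedIn? Left 8 3 fresh} tt
secured-fresh Right = toWitness {a? = securedIn? Right 8 3 fresh} tt

-- Snort on the flower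

-- Indexing by the player lets the strategy be treated once for both players.
data Option : Player → Game → Game → Set where
  leftOption  : ∀ {m n} {Gᴸ : Fin m → Game} {Gᴿ : Fin n → Game} i → Option Left ⟨ Gᴸ ∣ Gᴿ ⟩ (Gᴸ i)
  rightOption : ∀ {m n} {Gᴸ : Fin m → Game} {Gᴿ : Fin n → Game} j → Option Right ⟨ Gᴸ ∣ Gᴿ ⟩ (Gᴿ j)

Secures : Player → ℕ → Game → Set
Secures Left  k G = integer (+ k) ≤ᴳ G
Secures Right k G = G ≤ᴳ integer (ℤ.- + k)

leftOption⇒≰ : ∀ {G H K} → Option Left G H → K ≤ᴳ H → ¬ (G ≤ᴳ K)
leftOption⇒≰ (leftOption i) K≤H G≤K = ≤ᴳ⇒≰leftOption G≤K i K≤H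

rightOption⇒≱ : ∀ {G H K} → Option Right G H → H ≤ᴳ K → ¬ (K ≤ᴳ G)
rightOption⇒≱ (rightOption j) H≤K K≤G = ≤ᴳ⇒rightOption≰ K≤G j H≤K

-- A canonical integer of the sign favouring `p` has no option for the opponent and at most one for
-- `p`. The two hypotheses answer the opponent's moves in `G` and that single option.
secures : ∀ p k {G} →
  (∀ H → Option (opponent p) G H → ∃[ H′ ] (Option p H H′ × Secures p k H′)) →
  (∀ l → k ≡ suc l → ∃[ H ] (Option p G H × Secures p l H)) →
  Secures p k G
secures Left zero {⟨ _ ∣ _ ⟩} replies tempo =
  (λ ()) , λ j → let _ , o , s = replies _ (rightOption j) in leftOption⇒≰ o s
secures Left (suc k) {⟨ _ ∣ _ ⟩} replies tempo =
  (λ _ → let _ , o , s = tempo k refl in leftOption⇒≰ o s) ,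
  λ j → let _ , o , s = replies _ (rightOption j) in leftOption⇒≰ o s
secures Right zero {⟨ _ ∣ _ ⟩} replies tempo =
  (λ i → let _ , o , s = replies _ (leftOption i) in rightOption⇒≱ o s) , λ ()
-- The split follows the separate clauses of `integer` for -1 and for smaller numbers.
secures Right (suc zero) {⟨ _ ∣ _ ⟩} replies tempo =
  (λ i → let _ , o , s = replies _ (leftOption i) in rightOption⇒≱ o s) ,
  λ _ → let _ , o , s = tempo zero refl in rightOption⇒≱ o s
secures Right (suc (suc k)) {⟨ _ ∣ _ ⟩} replies tempo =
  (λ i → let _ , o , s = replies _ (leftOption i) in rightOption⇒≱ o s) ,
  λ _ → let _ , o , s = tempo (suc k) refl in rightOption⇒≱ o s

module _ (Γ : Graph) where
  open Graph Γ hiding (sym)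
  open Snort Γ

  legalMove⇒option : ∀ p {k} c v → Legal p c v →
                     Option p (position (suc k) c) (position k (play p v c))
  legalMove⇒option p {k} c v legal = subst
    (λ u → Option p (position (suc k) c) (position k (play p u c)))
    (sym (lookup-index v∈moves)) (option p (index v∈moves))
    where
    v∈moves : v ∈ moves p c
    v∈moves = ∈-filter⁺ (legal? p c) (∈-allFin v) legal
    option : ∀ p i → Option p (position (suc k) c)
                              (position k (play p (List.lookup (moves p c) i) c))
    option Left  = leftOption
    option Right = rightOption

  option⇒legalMove : ∀ p {k c H} → Option p (position (suc k) c) H →
                     ∃[ v ] (Legal p c v × H ≡ position k (play p v c))
  option⇒legalMove p {k} {c} o with option p o
    where
    option : ∀ p {H} → Option p (position (suc k) c) H →
             ∃[ i ] H ≡ position k (play p (List.lookup (moves p c) i) c)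
    option Left  (leftOption i)  = i , refl
    option Right (rightOption j) = j , refl
  ... | i , eq = _ , proj₂ (∈-filter⁻ (legal? p c) {xs = allFin order} (∈-lookup i)) , eq

  ¬option-zero : ∀ p {c H} → ¬ Option p (position zero c) H
  ¬option-zero Left  (leftOption ())
  ¬option-zero Right (rightOption ())

-- Finite sums and counting

sum : ∀ {n} → Vector ℕ n → ℕ
sum = foldr ℕ._+_ 0

sum-pred : ∀ {n} (f : Vector ℕ n) i {k} → f i ≡ suc k → suc (sum (updateAt f i pred)) ≡ sum f
sum-pred f zero eq rewrite eq = refl
sum-pred f (suc i) eq =
  trans (sym (ℕ.+-suc (f zero) _)) (cong (f zero ℕ.+_) (sum-pred (f ∘ suc) i eq))

sum-positive : ∀ {n} (f : Vector ℕ n) {k} → sum f ≡ suc k → ∃[ i ] ∃[ l ] f i ≡ suc l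
sum-positive {suc n} f eq with f zero in f₀
... | suc l = zero , l , f₀
... | zero  = let i , rest = sum-positive (f ∘ suc) eq in suc i , rest

sum-const : ∀ n k → sum {n} (λ _ → k) ≡ n ℕ.* k
sum-const zero    k = refl
sum-const (suc n) k = cong (k ℕ.+_) (sum-const n k)

unique⇒lookup-injective : ∀ {A : Set} {xs : List A} → Unique xs →
  ∀ {i j} → List.lookup xs i ≡ List.lookup xs j → i ≡ j
unique⇒lookup-injective (_ ∷ _)  {zero}  {zero}  _  = refl
unique⇒lookup-injective (x∉ ∷ _) {zero}  {suc j} eq =
  contradiction eq (All.lookup x∉ (∈-lookup j))
unique⇒lookup-injective (x∉ ∷ _) {suc i} {zero}  eq =
  contradiction (sym eq) (All.lookup x∉ (∈-lookup i))
unique⇒lookup-injective (_ ∷ u)  {suc i} {suc j} eq = cong suc (unique⇒lookup-injective u eq)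

-- The filtered list has no repetitions, so `f` injects its positions into `Fin d`. Degrees are
-- bounded this way.
length-filter≤ : ∀ {n d} {P : Fin n → Set} (P? : ∀ v → Dec (P v)) (f : Fin n → Fin d) →
  (∀ {v w} → P v → P w → f v ≡ f w → v ≡ w) → length (filter P? (allFin n)) ℕ.≤ d
length-filter≤ {n} P? f inj = Fin.injective⇒≤ λ {i} {j} eq →
  unique⇒lookup-injective (filter⁺ P? (allFin⁺ n)) (inj (satisfies i) (satisfies j) eq)
  where
  satisfies : ∀ i → _
  satisfies i = proj₂ (∈-filter⁻ P? {xs = allFin n} (∈-lookup i))

joined-sym : ∀ x y → T (joined x y) → T (joined y x)
joined-sym = toWitness {a? = all? λ x → all? λ y → T? (joined x y) →-dec T? (joined y x)} tt

joined-irrefl : ∀ x → ¬ T (joined x x)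
joined-irrefl = toWitness {a? = all? λ x → ¬? (T? (joined x x))} tt

-- The flower with `g` pairs of hubs

module _ (g : ℕ) where

  data Place : Set where
    centre : Place
    at     : Fin g → Fin 8 → Place

  Adjacent : Place → Place → Set
  Adjacent centre   centre   = ⊥
  Adjacent centre   (at _ x) = T (isHub x)
  Adjacent (at _ x) centre   = T (isHub x)
  Adjacent (at i x) (at j y) = i ≡ j × T (joined x y)

  adjacent? : ∀ u v → Dec (Adjacent u v)
  adjacent? centre   centre   = no λ ()
  adjacent? centre   (at _ x) = T? (isHub x)
  adjacent? (at _ x) centre   = T? (isHub x)
  adjacent? (at i x) (at j y) = i Fin.≟ j ×-dec T? (joined x y)

  adjacent-sym : ∀ u v → Adjacent u v → Adjacent v u
  adjacent-sym centre   (at _ _) hub = hub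
  adjacent-sym (at _ _) centre   hub = hub
  adjacent-sym (at _ x) (at _ y) (i≡j , x~y) = sym i≡j , joined-sym x y x~y

  adjacent-irrefl : ∀ u → ¬ Adjacent u u
  adjacent-irrefl (at _ x) (_ , x~x) = joined-irrefl x x~x

  place : Fin (suc (g ℕ.* 8)) → Place
  place zero    = centre
  place (suc v) = uncurry at (remQuot {g} 8 v)

  vertex : Place → Fin (suc (g ℕ.* 8))
  vertex centre   = zero
  vertex (at i x) = suc (combine i x)

  place-vertex : ∀ u → place (vertex u) ≡ u
  place-vertex centre   = refl
  place-vertex (at i x) = cong (uncurry at) (Fin.remQuot-combine i x)

  vertex-place : ∀ v → vertex (place v) ≡ v
  vertex-place zero    = refl
  vertex-place (suc v) = cong suc (Fin.combine-remQuot {g} 8 v)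

  vertex-injective : ∀ {i x j y} → vertex (at i x) ≡ vertex (at j y) → i ≡ j × x ≡ y
  vertex-injective {i} {x} {j} {y} eq = Fin.combine-injective i x j y (Fin.suc-injective eq)

  place-injective : ∀ {v w} → place v ≡ place w → v ≡ w
  place-injective {v} {w} eq =
    trans (sym (vertex-place v)) (trans (cong vertex eq) (vertex-place w))

  flower : Graph
  flower = record
    { order  = suc (g ℕ.* 8)
    ; _~_    = λ v w → Adjacent (place v) (place w)
    ; _~?_   = λ v w → adjacent? (place v) (place w)
    ; sym    = λ {v} {w} → adjacent-sym (place v) (place w)
    ; irrefl = λ { {v} refl → adjacent-irrefl (place v) }
    }

  open Graph flower using (_~_; _~?_; degree; maxDegree)
  open Snort flower

  -- No edge joins two pairs. Once the centre is coloured, legality of a move in a pair depends only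
  -- on the state of that pair and the owner of the centre.
  record Agrees (p : Player) (c : Colouring) (σ : Fin g → State) : Set where
    field
      at-centre : c zero ≡ just p
      at-module : ∀ i x → c (vertex (at i x)) ≡ lookup (σ i) x

  open Agrees

  module _ {p c σ} (agrees : Agrees p c σ) where

    legal⇒legalIn : ∀ {q i x} → Legal q c (vertex (at i x)) → LegalIn p q (σ i) x
    legal⇒legalIn {q} {i} {x} (uncoloured , free) =
      trans (sym (at-module agrees i x)) uncoloured ,
      (λ hub p≡q̄ → free zero (subst (λ u → Adjacent u centre) (sym (place-vertex (at i x))) hub)
                     (trans (at-centre agrees) (cong just p≡q̄))) ,
      (λ y x~y y≡q̄ → free (vertex (at i y))
        (subst₂ Adjacent (sym (place-vertex (at i x))) (sym (place-vertex (at i y))) (refl , x~y))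
        (trans (at-module agrees i y) y≡q̄))

    legalIn⇒legal : ∀ {q i x} → LegalIn p q (σ i) x → Legal q c (vertex (at i x))
    legalIn⇒legal {q} {i} {x} (uncoloured , freeHub , free) =
      trans (at-module agrees i x) uncoloured ,
      λ w x~w → free′ w (place w) (vertex-place w)
        (subst (λ u → Adjacent u (place w)) (place-vertex (at i x)) x~w)
      where
      free′ : ∀ w u → vertex u ≡ w → Adjacent (at i x) u → c w ≢ just (opponent q)
      free′ _ centre refl hub centre≡q̄ =
        freeHub hub (just-injective (trans (sym (at-centre agrees)) centre≡q̄))
      free′ _ (at _ y) refl (refl , x~y) y≡q̄ = free y x~y (trans (sym (at-module agrees i y)) y≡q̄)

    legal⇒at : ∀ {q v} → Legal q c v → ∃[ i ] ∃[ x ] v ≡ vertex (at i x)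
    legal⇒at {v = v} (uncoloured , _) = go (place v) (vertex-place v)
      where
      go : ∀ u → vertex u ≡ v → ∃[ i ] ∃[ x ] v ≡ vertex (at i x)
      go centre   refl = contradiction (trans (sym (at-centre agrees)) uncoloured) λ ()
      go (at i x) eq   = i , x , sym eq

    agrees-play : ∀ q i x →
      Agrees p (play q (vertex (at i x)) c) (updateAt σ i (_[ x ]≔ just q))
    at-centre (agrees-play q i x) = at-centre agrees
    at-module (agrees-play q i x) j y with j Fin.≟ i | y Fin.≟ x
    ... | yes refl | yes refl = trans (updateAt-updates (vertex (at i x)) c)
      (sym (trans (cong (λ s → lookup s x) (updateAt-updates i σ))
                  (lookup∘update x (σ i) (just q))))
    ... | yes refl | no y≢x = trans
      (updateAt-minimal (vertex (at i y)) (vertex (at i x)) c (y≢x ∘ proj₂ ∘ vertex-injective))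
      (trans (at-module agrees i y)
        (sym (trans (cong (λ s → lookup s y) (updateAt-updates i σ))
                    (lookup∘update′ y≢x (σ i) (just q)))))
    ... | no j≢i | _ = trans
      (updateAt-minimal (vertex (at j y)) (vertex (at i x)) c (j≢i ∘ proj₁ ∘ vertex-injective))
      (trans (at-module agrees j y) (cong (λ s → lookup s y) (sym (updateAt-minimal j i σ j≢i))))

  module _ (p : Player) where

    Others : (Fin g → ℕ) → (Fin g → ℕ) → (Fin g → State) → Fin g → Set
    Others n k σ i = ∀ j → j ≢ i → SecuredIn p (n j) (k j) (σ j)

    MovesToSecure : ℕ → Colouring → ℕ → Set
    MovesToSecure f c k = ∃[ H ] (Option p (position f c) H × Secures p k H)

    -- Spare moves and budgets add over the pairs: `p` answers in the pair where the opponent moved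
    -- and spends a tempo in any pair that has one. The bound on `sum n` keeps the game tree deep
    -- enough.
    position-secures : ∀ f c σ n k → Agrees p c σ →
      (∀ i → SecuredIn p (n i) (k i) (σ i)) → sum n ℕ.≤ f → Secures p (sum k) (position f c)

    -- Pair `i` is exempt from being secured: either the opponent has just moved there, or `p` is
    -- about to use up one of its spare moves.
    moves-to-secure : ∀ f c σ n k i → Agrees p c σ → Others n k σ i →
      MovesTo p (n i) (k i) (σ i) → sum n ℕ.≤ f → MovesToSecure f c (sum k)

    moves-to-secure f c σ n k i agrees others moves Σn≤f with n i in nᵢ
    -- A positive budget in one pair makes `f` positive; its decrease makes the mutual recursion
    -- terminate.
    ... | suc m with f | subst (ℕ._≤ f) (sym (sum-pred n i nᵢ)) Σn≤f
    ...   | suc f | s≤s Σn≤f =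
      let x , legal , secured = moves in
      _ , legalMove⇒option flower p c (vertex (at i x)) (legalIn⇒legal agrees legal) ,
      position-secures f _ _ (updateAt n i pred) k (agrees-play agrees p i x) (all x secured) Σn≤f
      where
      all : ∀ x → SecuredIn p m (k i) (σ i [ x ]≔ just p) →
            ∀ j → SecuredIn p (updateAt n i pred j) (k j) (updateAt σ i (_[ x ]≔ just p) j)
      all x secured j with j Fin.≟ i
      ... | yes refl = subst₂ (λ m → SecuredIn p m (k i))
        (sym (trans (updateAt-updates i n) (cong pred nᵢ))) (sym (updateAt-updates i σ)) secured
      ... | no j≢i = subst₂ (λ m → SecuredIn p m (k j))
        (sym (updateAt-minimal j i n j≢i)) (sym (updateAt-minimal j i σ j≢i)) (others j j≢i)

    position-secures f c σ n k agrees secured Σn≤f = secures p (sum k) (reply f Σn≤f) tempo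
      where
      reply : ∀ f → sum n ℕ.≤ f → ∀ H → Option (opponent p) (position f c) H →
              ∃[ H′ ] (Option p H H′ × Secures p (sum k) H′)
      reply zero    Σn≤f H o = ⊥-elim (¬option-zero flower (opponent p) {c} o)
      reply (suc f) Σn≤f H o
        with v , legal , refl ← option⇒legalMove flower (opponent p) {c = c} o
        with i , x , refl ← legal⇒at agrees legal
        with n i in nᵢ | proj₂ (secured i)
      ... | zero  | noMove  = contradiction (legal⇒legalIn agrees legal) (noMove x)
      ... | suc m | replies = moves-to-secure f _
        (updateAt σ i (_[ x ]≔ just (opponent p))) (updateAt n i pred) k i
        (agrees-play agrees (opponent p) i x)
        (λ j j≢i → subst₂ (λ m → SecuredIn p m (k j))
          (sym (updateAt-minimal j i n j≢i)) (sym (updateAt-minimal j i σ j≢i)) (secured j))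
        (subst₂ (λ m → MovesTo p m (k i))
          (sym (trans (updateAt-updates i n) (cong pred nᵢ))) (sym (updateAt-updates i σ))
          (replies x (legal⇒legalIn agrees legal)))
        (ℕ.≤-pred (subst (ℕ._≤ suc f) (sym (sum-pred n i nᵢ)) Σn≤f))
      tempo : ∀ l → sum k ≡ suc l → ∃[ H ] (Option p (position f c) H × Secures p l H)
      -- Some pair still has a spare move; it is spent there and `k i` drops by one.
      tempo l Σk≡ with i , m , kᵢ ← sum-positive k Σk≡ =
        subst (MovesToSecure f c) (ℕ.suc-injective (trans (sum-pred k i kᵢ) Σk≡))
          (moves-to-secure f c σ n (updateAt k i pred) i agrees
            (λ j j≢i → subst (λ m → SecuredIn p (n j) m (σ j))
              (sym (updateAt-minimal j i k j≢i)) (secured j))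
            (subst (λ m → MovesTo p (n i) m (σ i))
              (sym (trans (updateAt-updates i k) (cong pred kᵢ)))
              (subst (λ m → Tempo p (n i) m (σ i)) kᵢ (proj₁ (secured i))))
            Σn≤f)

  uncoloured : Colouring
  uncoloured _ = nothing

  opening-secures : ∀ p → MovesToSecure p (suc (g ℕ.* 8)) uncoloured (g ℕ.* 3)
  opening-secures p = _ , legalMove⇒option flower p uncoloured zero (refl , λ _ _ ()) ,
    subst (λ k → Secures p k (position (g ℕ.* 8) (play p zero uncoloured))) (sum-const g 3)
      (position-secures p (g ℕ.* 8) (play p zero uncoloured) (const fresh) (const 8) (const 3)
        (record { at-centre = refl ; at-module = λ i x → sym (lookup-replicate x nothing) })
        (λ _ → secured-fresh p) (ℕ.≤-reflexive (sum-const g 8)))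

  snort≰ : ¬ (snort flower ≤ᴳ integer (+ (g ℕ.* 3)))
  snort≰ = let _ , o , s = opening-secures Left in leftOption⇒≰ o s

  snort≱ : ¬ (integer (ℤ.- + (g ℕ.* 3)) ≤ᴳ snort flower)
  snort≱ = let _ , o , s = opening-secures Right in rightOption⇒≱ o s

  -- The maximum degree of the flower

  parity : Fin 8 → Fin 2
  parity x = toℕ x mod 2

  parity-injective : ∀ x y → T (isHub x) → T (isHub y) → parity x ≡ parity y → x ≡ y
  parity-injective = toWitness {a? = all? λ x → all? λ y →
    T? (isHub x) →-dec T? (isHub y) →-dec parity x Fin.≟ parity y →-dec x Fin.≟ y} tt

  -- Injective on the neighbours of the centre: these are hubs, and the two hubs of a pair differ in
  -- parity.
  side : Place → Fin (suc (g ℕ.* 2))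
  side centre   = zero
  side (at i x) = suc (combine i (parity x))

  -- Injective on the neighbours of a vertex off the centre, which lie in its own pair or at the
  -- centre.
  slot : Place → Fin 9
  slot centre   = zero
  slot (at _ x) = suc x

  -- A crude bound above both `1 + 2g` and 9. The additive constant is harmless against a
  -- temperature of at least `3g`.
  degree≤ : ∀ v → degree v ℕ.≤ 9 ℕ.+ g ℕ.* 2
  degree≤ v = bound (place v) refl
    where
    bound : ∀ u → place v ≡ u → degree v ℕ.≤ 9 ℕ.+ g ℕ.* 2
    bound centre eq = ℕ.≤-trans
      (length-filter≤ (v ~?_) (side ∘ place) λ {w} {w′} v~w v~w′ →
        place-injective ∘ side-injective (place w) (place w′)
          (subst (λ u → Adjacent u (place w)) eq v~w) (subst (λ u → Adjacent u (place w′)) eq v~w′))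
      (s≤s (ℕ.m≤n+m (g ℕ.* 2) 8))
      where
      side-injective : ∀ u u′ → Adjacent centre u → Adjacent centre u′ → side u ≡ side u′ → u ≡ u′
      side-injective (at i x) (at j y) hub hub′ eq =
        let i≡j , x≡y = Fin.combine-injective i (parity x) j (parity y) (Fin.suc-injective eq) in
        cong₂ at i≡j (parity-injective x y hub hub′ x≡y)
    bound (at i x) eq = ℕ.≤-trans
      (length-filter≤ (v ~?_) (slot ∘ place) λ {w} {w′} v~w v~w′ →
        place-injective ∘ slot-injective (place w) (place w′)
          (subst (λ u → Adjacent u (place w)) eq v~w) (subst (λ u → Adjacent u (place w′)) eq v~w′))
      (ℕ.m≤m+n 9 (g ℕ.* 2))
      where
      slot-injective : ∀ u u′ → Adjacent (at i x) u → Adjacent (at i x) u′ →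
                       slot u ≡ slot u′ → u ≡ u′
      slot-injective centre   centre   _ _ _ = refl
      slot-injective (at j y) (at k z) (i≡j , _) (i≡k , _) eq =
        cong₂ at (trans (sym i≡j) i≡k) (Fin.suc-injective eq)

  maxDegree≤ : maxDegree ℕ.≤ 9 ℕ.+ g ℕ.* 2
  maxDegree≤ = max≤v⁺ z≤n (All.map⁺ (All.universal degree≤ (allFin _)))

-- The choice of g makes ⌊M⌋ + 1 + (9 + 2g) ≤ 3g.
temperature-maxDegree> : ∀ M g → g ≡ 10 ℕ.+ ℤ.∣ floor M ∣ → ∀ {θ} →
  Regular (snort (flower g)) θ → M < temperature θ - (+ Graph.maxDegree (flower g)) / 1
temperature-maxDegree> M g g≡ {θ} R =
  <-linear (<-floor+1 M) (≤-trans bound (temperature≥ R (+ (g ℕ.* 3)) (snort≰ g) (snort≱ g)))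
    (rearrange M (floor M / 1) (+ D / 1) (temperature θ))
  where
  D = Graph.maxDegree (flower g)
  i≤∣i∣ : ∀ i → i ℤ.≤ + ℤ.∣ i ∣
  i≤∣i∣ (+ n)    = ℤ.≤-refl
  i≤∣i∣ -[1+ n ] = ℤ.-≤+
  total : ∀ m → suc m ℕ.+ (9 ℕ.+ (10 ℕ.+ m) ℕ.* 2) ≡ (10 ℕ.+ m) ℕ.* 3
  total = ℕ-solve-∀
  bound : floor M / 1 + 1ℚ + + D / 1 ≤ + (g ℕ.* 3) / 1
  bound = subst (_≤ + (g ℕ.* 3) / 1)
    (trans (/1-homo-+ (ℤ.suc (floor M)) (+ D)) (cong (_+ + D / 1) (/1-suc (floor M))))
    (/1-mono-≤ (ℤ.≤-trans (ℤ.+-mono-≤ (ℤ.suc-mono (i≤∣i∣ (floor M))) (ℤ.+≤+ (maxDegree≤ g)))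
      (ℤ.≤-reflexive (cong +_ (subst (λ g → suc ℤ.∣ floor M ∣ ℕ.+ (9 ℕ.+ g ℕ.* 2) ≡ g ℕ.* 3)
        (sym g≡) (total ℤ.∣ floor M ∣))))))
  rearrange : ∀ M f d t → M + (f + 1ℚ + t) ≡ t - d + (M + (f + 1ℚ + d))
  rearrange = solve-∀ ℚ-ring

theorem10 : ∀ (M : ℚ) → Σ[ G ∈ Graph ] ∃[ t ]
    (HasTemperature (snort G) t × t - (+ Graph.maxDegree G) / 1 > M)
theorem10 M = witness (10 ℕ.+ ℤ.∣ floor M ∣) refl
  where
  -- As a variable tied to its value by an equation, `g` does not let its ten known successors
  -- unfold the game tree.
  witness : ∀ g → g ≡ 10 ℕ.+ ℤ.∣ floor M ∣ → Σ[ G ∈ Graph ] ∃[ t ]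
    (HasTemperature (snort G) t × t - (+ Graph.maxDegree G) / 1 > M)
  witness g g≡ =
    let θ , R = regularThermograph (snort (flower g))
    in flower g , temperature θ , (θ , Regular.isThermograph R , refl) ,
       temperature-maxDegree> M g g≡ R
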